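{- In the simple game modeling the US legislative system, let $P$ be the president, $V$ the vice president, $S$ a senator and $R$ a representative. Then $P\succ S\succ R$ and $S\succeq V$. It follows that: (a) for any power index $\Phi$ for which $\Phi(P)\ne 0$ and $\Phi(S)\ne 0$, we have $\Phi(P)>\Phi(S)>\Phi(R)$ and $\Phi(S)\ge\Phi(V)$; (b) if $\Phi$ is the Banzhaf or the Shapley-Shubik index, then $\Phi(P)>\Phi(S)>\Phi(V)>\Phi(R)$.
   Context: The simple game modeling the US legislative system has $n=537$ players: the president, the vice president, 100 senators and 435 representatives. The "full Senate" is the 101-element set consisting of the 100 senators and the vice president. The minimal winning coalitions are of two types: (I) the president, 51 members of the full Senate, and 218 representatives; (II) 67 senators (the vice president does not count here) and 290 representatives. A coalition (set of players) is winning iff it contains a coalition of type I or II. A player $i$ in a coalition $T$ is critical in $T$ if $T$ is winning and $T\setminus\{i\}$ is not. For a player $i$, $c_i(k)$ is the number of coalitions of size $k$ in which $i$ is critical. For players $i,j$: $i\succeq j$ means $c_i(k)\ge c_j(k)$ for all $1\le k\le n$; $i\succ j$ means $c_i(k)>c_j(k)$ for all $k$ such that $c_i(k)$ and $c_j(k)$ are not both zero. A power index $\Phi$ is given by a weighting vector $(\lambda_1,\dots,\lambda_n)$ with $\lambda_k\ge0$ and $\sum_{k=1}^n\lambda_k\binom{n-1}{k-1}=1$, with $\Phi(i)=\sum_{k=1}^n\lambda_kc_i(k)$. The Banzhaf index has $\lambda_k=1/2^{n-1}$ and the Shapley-Shubik index has $\lambda_k=1/\left(n\binom{n-1}{k-1}\right)$.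 -}

module Defs where

open import Algebra.Bundles using (CommutativeRing)
import Algebra.Definitions.RawMonoid as RawMonoidDefs
open import Data.Fin using (Fin; zero; suc; toℕ; _↑ˡ_; _↑ʳ_)
open import Data.Fin.Subset
  using (Subset; inside; outside; _∈_; _⊆_; _∩_; _∪_; _-_; ⁅_⁆; ∣_∣; ⊤; ⊥)
open import Data.Fin.Subset.Properties using (_∈?_; _⊆?_; ⊆-trans; anySubset?)
open import Data.List using (List; []; _∷_; _++_; map; filter; length)
open import Data.Nat using (ℕ; zero; suc; _*_; _∸_; _^_; _≤_; _≥_; _>_; _≟_)
open import Data.Nat.Combinatorics using (_C_)
open import Data.Product using (_×_; _,_; ∃-syntax)
open import Data.Sum using (_⊎_)
import Data.Vec as Vec
open import Level using (Level; 0ℓ) renaming (suc to ℓsuc; _⊔_ to _⊔ˡ_)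
open import Relation.Binary.Core using (Rel)
import Relation.Binary.Construct.StrictToNonStrict as StrictToNonStrict
open import Relation.Binary.PropositionalEquality using (_≡_)
open import Relation.Binary.Structures using (IsStrictTotalOrder)
open import Relation.Nullary using (¬_; Dec)
open import Relation.Nullary.Decidable using (_×-dec_; _⊎-dec_; ¬?)
open import Relation.Unary using (Pred; Decidable)

record SimpleGame (n : ℕ) : Set₁ where
  field
    Winning  : Pred (Subset n) 0ℓ
    winning? : Decidable Winning
    monotone : ∀ {T U} → T ⊆ U → Winning T → Winning U

generatedBy : ∀ {n} {Minimal : Pred (Subset n) 0ℓ} → Decidable Minimal → SimpleGame n
generatedBy {Minimal = Minimal} minimal? = record
  { Winning  = λ T → ∃[ U ] (U ⊆ T × Minimal U)
  ; winning? = λ T → anySubset? (λ U → (U ⊆? T) ×-dec minimal? U)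
  ; monotone = λ { T⊆T′ (U , U⊆T , min) → U , ⊆-trans U⊆T T⊆T′ , min }
  }

subsets : ∀ n → List (Subset n)
subsets zero    = Vec.[] ∷ []
subsets (suc n) = map (inside Vec.∷_) (subsets n) ++ map (outside Vec.∷_) (subsets n)

module _ {n : ℕ} (G : SimpleGame n) where
  open SimpleGame G

  Critical : Fin n → Pred (Subset n) 0ℓ
  Critical i T = i ∈ T × Winning T × ¬ Winning (T - i)

  critical? : ∀ i → Decidable (Critical i)
  critical? i T = (i ∈? T) ×-dec (winning? T ×-dec ¬? (winning? (T - i)))

  -- c_i(k)
  criticalCount : Fin n → ℕ → ℕ
  criticalCount i k =
    length (filter (λ T → critical? i T ×-dec (∣ T ∣ ≟ k)) (subsets n))

infix 4 _⪰[_]_ _≻[_]_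

_⪰[_]_ : ∀ {n} → Fin n → SimpleGame n → Fin n → Set
_⪰[_]_ {n} i G j =
  ∀ k → 1 ≤ k → k ≤ n → criticalCount G i k ≥ criticalCount G j k

_≻[_]_ : ∀ {n} → Fin n → SimpleGame n → Fin n → Set
_≻[_]_ {n} i G j =
  ∀ k → 1 ≤ k → k ≤ n →
  ¬ (criticalCount G i k ≡ 0 × criticalCount G j k ≡ 0) →
  criticalCount G i k > criticalCount G j k

-- Linearly ordered fields, standing in for the real numbers.  The inverse is
-- total, with an unspecified value at 0#.

record OrderedField (c ℓ₁ ℓ₂ : Level) : Set (ℓsuc (c ⊔ˡ ℓ₁ ⊔ˡ ℓ₂)) where
  infix  4 _<_
  infix  8 _⁻¹
  field
    commutativeRing : CommutativeRing c ℓ₁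
  open CommutativeRing commutativeRing public renaming (_*_ to _*ᶠ_)
  field
    _⁻¹                : Carrier → Carrier
    *-inverseʳ         : ∀ {x} → x ≉ 0# → x *ᶠ x ⁻¹ ≈ 1#
    0≉1                : 0# ≉ 1#
    _<_                : Rel Carrier ℓ₂
    isStrictTotalOrder : IsStrictTotalOrder _≈_ _<_
    +-monoʳ-<          : ∀ x {y z} → y < z → x + y < x + z
    *-pos              : ∀ {x y} → 0# < x → 0# < y → 0# < x *ᶠ y

  open StrictToNonStrict _≈_ _<_ public using () renaming (_≤_ to _≤ᶠ_)
  open RawMonoidDefs +-rawMonoid public using (sum) renaming (_×_ to _·_)

  infix 4 _>ᶠ_ _≥ᶠ_

  _>ᶠ_ : Rel Carrier ℓ₂
  x >ᶠ y = y < x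

  _≥ᶠ_ : Rel Carrier (ℓ₁ ⊔ˡ ℓ₂)
  x ≥ᶠ y = y ≤ᶠ x

-- A vector w : Fin n → Carrier encodes (λ₁, …, λₙ) with λ_k at index k - 1,
-- so that w m multiplies c_i(m + 1) and goes with the binomial C(n - 1, m).

module PowerIndices {c ℓ₁ ℓ₂} (K : OrderedField c ℓ₁ ℓ₂) where
  open OrderedField K

  record IsWeighting {n : ℕ} (w : Fin n → Carrier) : Set (ℓ₁ ⊔ˡ ℓ₂) where
    field
      nonNegative : ∀ m → w m ≥ᶠ 0#
      normalised  : sum (λ m → ((n ∸ 1) C toℕ m) · w m) ≈ 1#

  powerIndex : ∀ {n} → SimpleGame n → (Fin n → Carrier) → Fin n → Carrier
  powerIndex G w i = sum (λ m → criticalCount G i (suc (toℕ m)) · w m)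

  banzhaf : ∀ n → Fin n → Carrier
  banzhaf n m = ((2 ^ (n ∸ 1)) · 1#) ⁻¹

  shapleyShubik : ∀ n → Fin n → Carrier
  shapleyShubik n m = ((n * ((n ∸ 1) C toℕ m)) · 1#) ⁻¹

-- The players are ordered as: president, vice president, 100 senators,
-- 435 representatives.

president : Fin 537
president = zero

vicePresident : Fin 537
vicePresident = suc zero

senator : Fin 100 → Fin 537
senator s = 2 ↑ʳ (s ↑ˡ 435)

representative : Fin 435 → Fin 537
representative r = 2 ↑ʳ (100 ↑ʳ r)

senators : Subset 537
senators = outside Vec.∷ outside Vec.∷ (⊤ {100} Vec.++ ⊥ {435})

representatives : Subset 537
representatives = outside Vec.∷ outside Vec.∷ (⊥ {100} Vec.++ ⊤ {435})

fullSenate : Subset 537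
fullSenate = senators ∪ ⁅ vicePresident ⁆

TypeI : Pred (Subset 537) 0ℓ
TypeI U = president ∈ U × ∣ U ∩ fullSenate ∣ ≡ 51 × ∣ U ∩ representatives ∣ ≡ 218

TypeII : Pred (Subset 537) 0ℓ
TypeII U = U ⊆ senators ∪ representatives
         × ∣ U ∩ senators ∣ ≡ 67 × ∣ U ∩ representatives ∣ ≡ 290

MinimalWinning : Pred (Subset 537) 0ℓ
MinimalWinning U = TypeI U ⊎ TypeII U

minimalWinning? : Decidable MinimalWinning
minimalWinning? U =
  ((president ∈? U) ×-dec
    ((∣ U ∩ fullSenate ∣ ≟ 51) ×-dec (∣ U ∩ representatives ∣ ≟ 218)))
  ⊎-dec
  ((U ⊆? (senators ∪ representatives)) ×-dec
    ((∣ U ∩ senators ∣ ≟ 67) ×-dec (∣ U ∩ representatives ∣ ≟ 290)))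

usLegislature : SimpleGame 537
usLegislature = generatedBy minimalWinning?

{-# OPTIONS --safe #-}

-- P can replace S: exchanging them keeps a winning coalition with S but not P
-- winning.  Exchanging therefore embeds the coalitions of size k in which S is
-- critical into those in which P is, and the inequality is strict as soon as one
-- coalition lets P replace S but not S replace P.  Against V and R, conditioning
-- on the membership of P and V turns c_S, c_V and c_R into short sums of products
-- of two binomial coefficients, which are compared size by size.  For the Banzhaf
-- and Shapley-Shubik indices λ_k is a natural number times a common factor
-- (1 / 2^(n-1), respectively (k-1)! (n-k)! times 1 / n!), so S > V > R becomes an
-- inequality between natural numbers.

module Submission where

open import Defs

-- Opened without an argument: opening PowerIndices K would create a copy of
-- powerIndex, and comparing two copies unfolds the critical counts of the
-- 537-player game.
open PowerIndices

import Algebra.Properties.CommutativeSemigroup as CommutativeSemigroupProperties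
import Algebra.Properties.Monoid.Mult as MonoidMult
import Algebra.Properties.Ring as RingProperties
import Algebra.Properties.Semiring.Mult as SemiringMult
open import Data.Bool as Bool using (Bool; true; false; if_then_else_)
open import Data.Fin using (Fin; zero; suc; toℕ; fromℕ<; _↑ˡ_; _↑ʳ_)
import Data.Fin.Properties as Fin
open import Data.Fin.Subset
  using (Subset; inside; outside; _∈_; _∉_; _⊆_; _-_; ∣_∣; _∩_; _∪_; ⊤; ⊥)
open import Data.Fin.Subset.Properties
  using (∣p∣≤n; ∣p∣≤∣x∷p∣; ∣⊥∣≡0; ∣⊤∣≡n; ∩-zeroʳ; ∩-identityʳ; ∪-identityʳ; ∪-identityˡ;
         ⊆⊤; ⊆-refl; p⊆q⇒∣p∣≤∣q∣; x∈p∩q⁺; x∈p∩q⁻; drop-∷-⊆; s⊆s; p─⊥≡p)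
open import Data.List as List using (List; []; _∷_; filter; length)
import Data.List.Properties as List
open import Data.Nat as ℕ using (ℕ; zero; suc; _∸_; _^_; _!; z≤n; s≤s)
open import Data.Nat.Combinatorics
  using (_C_; nCk+nC[k+1]≡[n+1]C[k+1]; nCk≡n!/k![n-k]!; k![n∸k]!∣n!)
open import Data.Nat.DivMod using (m/n*n≡m)
import Data.Nat.Properties as ℕ
open import Data.Product using (_×_; _,_; ∃-syntax; uncurry; swap)
open import Data.Product.Function.NonDependent.Propositional using (_×-⇔_)
open import Data.Sum using (_⊎_; inj₁; inj₂; [_,_]′)
open import Data.Unit using (tt)
open import Data.Vec using ([]; _∷_; _++_; here; there; insertAt; cast; splitAt)
import Data.Vec.Functional as Vector
open import Data.Vec.Functional.Relation.Binary.Pointwise.Properties using (foldr-cong)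
open import Data.Vec.Properties using (cast-is-id)
open import Function using (_∘_; id; _⇔_; mk⇔; module Equivalence)
import Function.Properties.Equivalence as ⇔
open import Function.Related.Propositional using (≡⇒; equivalence)
open import Function.Related.TypeIsomorphisms using (¬-cong-⇔)
open import Level using (Level; 0ℓ)
open import Relation.Binary.Definitions using (tri<; tri≈; tri>)
open import Relation.Binary.PropositionalEquality as ≡ using (_≡_)
import Relation.Binary.Reasoning.Setoid as SetoidReasoning
open import Relation.Binary.Structures using (IsStrictTotalOrder)
open import Relation.Nullary using (¬_; Dec; yes; no; does; contradiction)
open import Relation.Nullary.Decidable
  using (_×-dec_; _⊎-dec_; ¬?; does-⇔; dec-true; dec-false; toWitness)
open import Relation.Unary using (Pred; Decidable)

-- Neither of S and R can replace the other: when P is joined by exactly 51 members of the full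
-- Senate and exactly 218 representatives, a loss in one chamber cannot be made up in the other. So
-- S ≻ R has no exchange argument and needs the counts themselves. Nor can S ⪰ V be made strict: at
-- size 270 every winning coalition is of type I, where S and V are interchangeable, so the counts
-- agree. V and R are incomparable size by size: V is critical more often at k = 270, R at k = 358.
-- Hence V > R in (b) depends on the two weightings and is a statement about totals. The numerical
-- facts are settled by evaluating binomials; the second concern is that nothing ranging over the
-- 2^537 coalitions gets unfolded on the way.

opaque
  -- Opaque, so that comparing the totals of two players does not evaluate their critical counts;
  -- `weightedTotal-≡` unfolds it propositionally.
  weightedTotal : ℕ → (ℕ → ℕ) → (ℕ → ℕ) → ℕ
  weightedTotal n c g = Vector.foldr ℕ._+_ 0 {n} λ m → c (suc (toℕ m)) ℕ.* g (toℕ m)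

  weightedTotal-≡ : ∀ n c g →
    weightedTotal n c g ≡ Vector.foldr ℕ._+_ 0 {n} λ m → c (suc (toℕ m)) ℕ.* g (toℕ m)
  weightedTotal-≡ n c g = ≡.refl

  weightedTotal-cong : ∀ n g {c d : ℕ → ℕ} → (∀ k → c k ≡ d k) →
    weightedTotal n c g ≡ weightedTotal n d g
  weightedTotal-cong n g c≗d = foldr-cong {R = _≡_} {S = _≡_} (≡.cong₂ ℕ._+_) ≡.refl {n}
    λ m → ≡.cong (ℕ._* g (toℕ m)) (c≗d (suc (toℕ m)))

factorialWeight : ℕ → ℕ → ℕ
factorialWeight n m = m ! ℕ.* (n ∸ m) !

-- The factorials in the binomial cancel. So the weight 1 / ((n + 1) C(n, m)) is
-- `factorialWeight n m` times 1 / (n + 1)!, a factor common to all sizes.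
*-C*factorialWeight : ∀ n m → m ℕ.≤ n → suc n ℕ.* (n C m) ℕ.* factorialWeight n m ≡ suc n !
*-C*factorialWeight n m m≤n = ≡.trans (ℕ.*-assoc (suc n) (n C m) _)
  (≡.cong (suc n ℕ.*_) (≡.trans
    (≡.cong (ℕ._* factorialWeight n m) (nCk≡n!/k![n-k]! m≤n))
    (m/n*n≡m {{ℕ.m*n≢0 (m !) ((n ∸ m) !) {{m ℕ.!≢0}} {{(n ∸ m) ℕ.!≢0}}}} (k![n∸k]!∣n! m≤n))))

*-C-nonZero : ∀ n m → m ℕ.≤ n → ℕ.NonZero (suc n ℕ.* (n C m))
*-C-nonZero n m m≤n = ℕ.≢-nonZero λ N≡0 → ℕ.≢-nonZero⁻¹ (suc n !) {{suc n ℕ.!≢0}}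
  (≡.trans (≡.sym (*-C*factorialWeight n m m≤n)) (≡.cong (ℕ._* factorialWeight n m) N≡0))

-- Ordered fields and comparison of power indices

module PowerIndexProperties {c ℓ₁ ℓ₂} (K : OrderedField c ℓ₁ ℓ₂) where
  open OrderedField K hiding (zero)
  open IsStrictTotalOrder isStrictTotalOrder using (compare; <-respˡ-≈; <-respʳ-≈)
    renaming (trans to <-trans; irrefl to <-irrefl; asym to <-asym)
  open MonoidMult +-monoid using (×-congʳ; ×-congˡ; ×-homo-+; ×-assocˡ; ×-homo-1)
  open SemiringMult semiring using (×1-homo-*; ×-assoc-*)
  open RingProperties ring using (-‿distribʳ-*; -‿involutive)
  open SetoidReasoning setoid

  private
    <-resp : ∀ {w x y z} → w ≈ x → y ≈ z → w < y → x < z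
    <-resp w≈x y≈z w<y = <-respˡ-≈ w≈x (<-respʳ-≈ y≈z w<y)

  pos⇒≉0 : ∀ {x} → 0# < x → x ≉ 0#
  pos⇒≉0 0<x x≈0 = <-irrefl (sym x≈0) 0<x

  +-mono-< : ∀ {w x y z} → w < x → y < z → w + y < x + z
  +-mono-< {w} {x} {y} {z} w<x y<z =
    <-trans (+-monoʳ-< w y<z) (<-resp (+-comm z w) (+-comm z x) (+-monoʳ-< z w<x))

  +-mono-<-≈ : ∀ {w x y z} → w < x → y ≈ z → w + y < x + z
  +-mono-<-≈ {w} {x} {y} {z} w<x y≈z =
    <-resp (+-comm y w) (trans (+-congʳ y≈z) (+-comm z x)) (+-monoʳ-< y w<x)

  +-mono-≈-< : ∀ {w x y z} → w ≈ x → y < z → w + y < x + z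
  +-mono-≈-< {w} w≈x y<z = <-respʳ-≈ (+-congʳ w≈x) (+-monoʳ-< w y<z)

  +-mono-≤ : ∀ {w x y z} → w ≤ᶠ x → y ≤ᶠ z → w + y ≤ᶠ x + z
  +-mono-≤ (inj₁ w<x) (inj₁ y<z) = inj₁ (+-mono-< w<x y<z)
  +-mono-≤ (inj₁ w<x) (inj₂ y≈z) = inj₁ (+-mono-<-≈ w<x y≈z)
  +-mono-≤ (inj₂ w≈x) (inj₁ y<z) = inj₁ (+-mono-≈-< w≈x y<z)
  +-mono-≤ (inj₂ w≈x) (inj₂ y≈z) = inj₂ (+-cong w≈x y≈z)

  neg-pos : ∀ {x} → x < 0# → 0# < - x
  neg-pos {x} x<0 = <-resp (-‿inverseˡ x) (+-identityʳ (- x)) (+-monoʳ-< (- x) x<0)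

  0<1 : 0# < 1#
  0<1 with compare 0# 1#
  ... | tri< 0<1 _ _ = 0<1
  ... | tri≈ _ 0≈1 _ = contradiction 0≈1 0≉1
  -- Were 1 negative, (- 1)(- 1) would be a product of positive elements, and it equals 1.
  ... | tri> _ _ 1<0 = <-respʳ-≈ square (*-pos (neg-pos 1<0) (neg-pos 1<0))
    where
    square : - 1# *ᶠ - 1# ≈ 1#
    square = begin
      - 1# *ᶠ - 1#   ≈⟨ -‿distribʳ-* (- 1#) 1# ⟨
      - (- 1# *ᶠ 1#) ≈⟨ -‿cong (*-identityʳ (- 1#)) ⟩
      - - 1#         ≈⟨ -‿involutive 1# ⟩
      1#             ∎

  -- A zero inverse would give 0 = 1, and a negative one would make x times - x⁻¹, which is - 1,
  -- positive.
  ⁻¹-pos : ∀ {x} → 0# < x → 0# < x ⁻¹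
  ⁻¹-pos {x} 0<x with compare 0# (x ⁻¹)
  ... | tri< 0<x⁻¹ _ _ = 0<x⁻¹
  ... | tri≈ _ 0≈x⁻¹ _ = contradiction
    (trans (sym (zeroʳ x)) (trans (*-congˡ 0≈x⁻¹) (*-inverseʳ (pos⇒≉0 0<x)))) 0≉1
  ... | tri> _ _ x⁻¹<0 = contradiction 0<-1 (<-asym -1<0)
    where
    0<-1 : 0# < - 1#
    0<-1 = <-respʳ-≈
      (trans (sym (-‿distribʳ-* x (x ⁻¹))) (-‿cong (*-inverseʳ (pos⇒≉0 0<x))))
      (*-pos 0<x (neg-pos x⁻¹<0))

    -1<0 : - 1# < 0#
    -1<0 = <-resp (+-identityʳ (- 1#)) (-‿inverseˡ 1#) (+-monoʳ-< (- 1#) 0<1)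

  ·-pos : ∀ n {x} → 0# < x → 0# < suc n · x
  ·-pos zero    0<x = <-respʳ-≈ (sym (+-identityʳ _)) 0<x
  ·-pos (suc n) 0<x = <-respˡ-≈ (+-identityʳ 0#) (+-mono-< 0<x (·-pos n 0<x))

  ·-mono-< : ∀ {m n x} → m ℕ.< n → 0# < x → m · x < n · x
  ·-mono-< {zero}  {suc n} _         0<x = ·-pos n 0<x
  ·-mono-< {suc m} {suc n} (s≤s m<n) 0<x = +-monoʳ-< _ (·-mono-< m<n 0<x)

  ·-≈0 : ∀ n {x} → x ≈ 0# → n · x ≈ 0#
  ·-≈0 zero    x≈0 = refl
  ·-≈0 (suc n) x≈0 = trans (+-cong x≈0 (·-≈0 n x≈0)) (+-identityʳ 0#)

  ·-mono-≤ : ∀ {m n x} → m ℕ.≤ n → x ≥ᶠ 0# → m · x ≤ᶠ n · x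
  ·-mono-≤ {m} {n} m≤n (inj₂ 0≈x) = inj₂ (trans (·-≈0 m (sym 0≈x)) (sym (·-≈0 n (sym 0≈x))))
  ·-mono-≤ {m} {n} m≤n (inj₁ 0<x) with ℕ.m≤n⇒m<n∨m≡n m≤n
  ... | inj₁ m<n    = inj₁ (·-mono-< m<n 0<x)
  ... | inj₂ ≡.refl = inj₂ refl

  -- Weak enough to hold termwise for Φ, yet strict for every sum other than 0#.
  infix 4 _≫_
  _≫_ : Carrier → Carrier → Set _
  x ≫ y = y < x ⊎ (x ≈ 0# × y ≈ 0#)

  +-mono-≫ : ∀ {w x y z} → w ≫ x → y ≫ z → w + y ≫ x + z
  +-mono-≫ (inj₁ x<w)         (inj₁ z<y)         = inj₁ (+-mono-< x<w z<y)
  +-mono-≫ (inj₁ x<w)         (inj₂ (y≈0 , z≈0)) = inj₁ (+-mono-<-≈ x<w (trans z≈0 (sym y≈0)))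
  +-mono-≫ (inj₂ (w≈0 , x≈0)) (inj₁ z<y)         = inj₁ (+-mono-≈-< (trans x≈0 (sym w≈0)) z<y)
  +-mono-≫ (inj₂ (w≈0 , x≈0)) (inj₂ (y≈0 , z≈0)) =
    inj₂ (trans (+-cong w≈0 y≈0) (+-identityʳ 0#) , trans (+-cong x≈0 z≈0) (+-identityʳ 0#))

  -- The first hypothesis is `≻` at a single coalition size, so `≻` passes to the index term by
  -- term; a vanishing weight falls under the second alternative of `_≫_`.
  ·-mono-≫ : ∀ {m n x} → (¬ (m ≡ 0 × n ≡ 0) → n ℕ.< m) → x ≥ᶠ 0# → m · x ≫ n · x
  ·-mono-≫ {m}     {n}     m≻n (inj₂ 0≈x) = inj₂ (·-≈0 m (sym 0≈x) , ·-≈0 n (sym 0≈x))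
  ·-mono-≫ {zero}  {zero}  m≻n (inj₁ 0<x) = inj₂ (refl , refl)
  ·-mono-≫ {suc m} {n}     m≻n (inj₁ 0<x) = inj₁ (·-mono-< (m≻n λ ()) 0<x)
  ·-mono-≫ {zero}  {suc n} m≻n (inj₁ 0<x) = inj₁ (·-mono-< (m≻n λ ()) 0<x)

  sum-mono-≤ : ∀ {n} {f g : Fin n → Carrier} → (∀ m → f m ≤ᶠ g m) → sum f ≤ᶠ sum g
  sum-mono-≤ {zero}  f≤g = inj₂ refl
  sum-mono-≤ {suc n} f≤g = +-mono-≤ (f≤g zero) (sum-mono-≤ (f≤g ∘ suc))

  sum-mono-≫ : ∀ {n} {f g : Fin n → Carrier} → (∀ m → f m ≫ g m) → sum f ≫ sum g
  sum-mono-≫ {zero}  f≫g = inj₂ (refl , refl)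
  sum-mono-≫ {suc n} f≫g = +-mono-≫ (f≫g zero) (sum-mono-≫ (f≫g ∘ suc))

  sum-nonneg : ∀ {n} {f : Fin n → Carrier} → (∀ m → f m ≥ᶠ 0#) → sum f ≥ᶠ 0#
  sum-nonneg {zero}  f≥0 = inj₂ refl
  sum-nonneg {suc n} f≥0 with +-mono-≤ (f≥0 zero) (sum-nonneg (f≥0 ∘ suc))
  ... | inj₁ lt = inj₁ (<-respˡ-≈ (+-identityʳ 0#) lt)
  ... | inj₂ eq = inj₂ (trans (sym (+-identityʳ 0#)) eq)

  module _ {n} (G : SimpleGame n) (w : Fin n → Carrier) (w≥0 : ∀ m → w m ≥ᶠ 0#) where

    powerIndex-mono-⪰ : ∀ i j → i ⪰[ G ] j → powerIndex K G w i ≥ᶠ powerIndex K G w j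
    powerIndex-mono-⪰ i j i⪰j = sum-mono-≤ λ m →
      ·-mono-≤ (i⪰j (suc (toℕ m)) (s≤s z≤n) (Fin.toℕ<n m)) (w≥0 m)

    powerIndex-mono-≻ : ∀ i j → i ≻[ G ] j → ¬ (powerIndex K G w i ≈ 0#) →
      powerIndex K G w i >ᶠ powerIndex K G w j
    powerIndex-mono-≻ i j i≻j Φi≉0 =
      [ id , (λ (Φi≈0 , _) → contradiction Φi≈0 Φi≉0) ]′
        (sum-mono-≫ λ m → ·-mono-≫ (i≻j (suc (toℕ m)) (s≤s z≤n) (Fin.toℕ<n m)) (w≥0 m))

    -- Serves the two concrete indices, where nonvanishing is not given: Φ(j) > Φ(l) ≥ 0 already
    -- excludes that the sums for `i` and `j` are both zero.
    powerIndex-mono-≻-> : ∀ i j l → i ≻[ G ] j → powerIndex K G w j >ᶠ powerIndex K G w l →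
      powerIndex K G w i >ᶠ powerIndex K G w j
    powerIndex-mono-≻-> i j l i≻j Φj>Φl =
      [ id , (λ (_ , Φj≈0) → contradiction (<-respʳ-≈ Φj≈0 Φj>Φl) (≥0⇒≮0 Φl≥0)) ]′
        (sum-mono-≫ λ m → ·-mono-≫ (i≻j (suc (toℕ m)) (s≤s z≤n) (Fin.toℕ<n m)) (w≥0 m))
      where
      Φl≥0 : powerIndex K G w l ≥ᶠ 0#
      Φl≥0 = sum-nonneg λ m → ·-mono-≤ {0} {criticalCount G l (suc (toℕ m))} z≤n (w≥0 m)

      ≥0⇒≮0 : ∀ {x} → x ≥ᶠ 0# → ¬ (x < 0#)
      ≥0⇒≮0 (inj₁ 0<x) x<0 = <-asym 0<x x<0
      ≥0⇒≮0 (inj₂ 0≈x) x<0 = <-irrefl (sym 0≈x) x<0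

  sum-proportional : ∀ {n} (f g : Fin n → ℕ) (w : Fin n → Carrier) t → (∀ m → w m ≈ (g m · 1#) *ᶠ t) →
    sum (λ m → f m · w m) ≈ (Vector.foldr ℕ._+_ 0 (λ m → f m ℕ.* g m) · 1#) *ᶠ t
  sum-proportional {zero}  f g w t w≈ = sym (zeroˡ t)
  sum-proportional {suc n} f g w t w≈ = begin
    f zero · w zero + sum (λ m → f (suc m) · w (suc m))
      ≈⟨ +-cong first (sum-proportional (f ∘ suc) (g ∘ suc) (w ∘ suc) t (w≈ ∘ suc)) ⟩
    ((f zero ℕ.* g zero) · 1#) *ᶠ t + (rest · 1#) *ᶠ t
      ≈⟨ distribʳ t _ _ ⟨
    ((f zero ℕ.* g zero) · 1# + rest · 1#) *ᶠ t
      ≈⟨ *-congʳ (×-homo-+ 1# (f zero ℕ.* g zero) rest) ⟨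
    ((f zero ℕ.* g zero ℕ.+ rest) · 1#) *ᶠ t ∎
    where
    rest : ℕ
    rest = Vector.foldr ℕ._+_ 0 (λ m → f (suc m) ℕ.* g (suc m))

    first : f zero · w zero ≈ ((f zero ℕ.* g zero) · 1#) *ᶠ t
    first = begin
      f zero · w zero                   ≈⟨ ×-congʳ (f zero) (w≈ zero) ⟩
      f zero · ((g zero · 1#) *ᶠ t)     ≈⟨ ×-assoc-* (f zero) (g zero · 1#) t ⟨
      (f zero · (g zero · 1#)) *ᶠ t     ≈⟨ *-congʳ (×-assocˡ 1# (f zero) (g zero)) ⟩
      ((f zero ℕ.* g zero) · 1#) *ᶠ t   ∎

  -- `OrderedField` does not postulate that `_⁻¹` respects `_≈_`, so an inverse is identified
  -- through its defining product.
  ⁻¹-unique : ∀ {x y} → 0# < x → x *ᶠ y ≈ 1# → x ⁻¹ ≈ y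
  ⁻¹-unique {x} {y} 0<x xy≈1 = begin
    x ⁻¹              ≈⟨ *-identityʳ (x ⁻¹) ⟨
    x ⁻¹ *ᶠ 1#        ≈⟨ *-congˡ xy≈1 ⟨
    x ⁻¹ *ᶠ (x *ᶠ y)  ≈⟨ *-assoc (x ⁻¹) x y ⟨
    x ⁻¹ *ᶠ x *ᶠ y    ≈⟨ *-congʳ (trans (*-comm (x ⁻¹) x) (*-inverseʳ (pos⇒≉0 0<x))) ⟩
    1# *ᶠ y           ≈⟨ *-identityˡ y ⟩
    y                 ∎

  1·-pos : ∀ n → .{{ℕ.NonZero n}} → 0# < n · 1#
  1·-pos (suc n) = ·-pos n 0<1

  banzhaf-pos : ∀ n m → 0# < banzhaf K n m
  banzhaf-pos n m = ⁻¹-pos (1·-pos (2 ^ (n ∸ 1)) {{ℕ.m^n≢0 2 (n ∸ 1)}})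

  module _ {n} (G : SimpleGame n) where

    powerIndex-proportional : (g : ℕ → ℕ) (w : Fin n → Carrier) (t : Carrier) → 0# < t →
      (∀ m → w m ≈ (g (toℕ m) · 1#) *ᶠ t) → ∀ i j →
      weightedTotal n (criticalCount G j) g ℕ.< weightedTotal n (criticalCount G i) g →
      powerIndex K G w i >ᶠ powerIndex K G w j
    powerIndex-proportional g w t 0<t w≈ i j lt =
      <-resp (sym (total j)) (sym (total i)) (scaled lt)
      where
      total : ∀ i → powerIndex K G w i ≈ (weightedTotal n (criticalCount G i) g · 1#) *ᶠ t
      total i = trans
        (sum-proportional (λ m → criticalCount G i (suc (toℕ m))) (g ∘ toℕ) w t w≈)
        (*-congʳ (×-congˡ (≡.sym (weightedTotal-≡ n (criticalCount G i) g))))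

      scaled : ∀ {a b} → a ℕ.< b → (a · 1#) *ᶠ t < (b · 1#) *ᶠ t
      scaled {a} {b} a<b = <-resp (move a) (move b) (·-mono-< a<b 0<t)
        where
        move : ∀ a → a · t ≈ (a · 1#) *ᶠ t
        move a = trans (×-congʳ a (sym (*-identityˡ t))) (sym (×-assoc-* a 1# t))

    banzhaf-< : ∀ i j →
      weightedTotal n (criticalCount G j) (λ _ → 1) ℕ.< weightedTotal n (criticalCount G i) (λ _ → 1) →
      powerIndex K G (banzhaf K n) i >ᶠ powerIndex K G (banzhaf K n) j
    banzhaf-< = powerIndex-proportional (λ _ → 1) (banzhaf K n) _
      (⁻¹-pos (1·-pos (2 ^ (n ∸ 1)) {{ℕ.m^n≢0 2 (n ∸ 1)}}))
      λ m → sym (trans (*-congʳ (×-homo-1 1#)) (*-identityˡ _))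

  -- The equation lets the literal 537 stand for `N` while the proof works with `suc n`.
  shapleyShubik-pos : ∀ {N n} → N ≡ suc n → ∀ m → 0# < shapleyShubik K N m
  shapleyShubik-pos {n = n} ≡.refl m = ⁻¹-pos (1·-pos (suc n ℕ.* (n C toℕ m))
    {{*-C-nonZero n (toℕ m) (ℕ.s≤s⁻¹ (Fin.toℕ<n m))}})

  shapleyShubik-proportional : ∀ n m →
    shapleyShubik K (suc n) m ≈ (factorialWeight n (toℕ m) · 1#) *ᶠ (((suc n !) · 1#) ⁻¹)
  shapleyShubik-proportional n m = ⁻¹-unique
    (1·-pos N {{*-C-nonZero n (toℕ m) (ℕ.s≤s⁻¹ (Fin.toℕ<n m))}}) (begin
    (N · 1#) *ᶠ ((g · 1#) *ᶠ ((suc n !) · 1#) ⁻¹)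
      ≈⟨ *-assoc _ _ _ ⟨
    (N · 1#) *ᶠ (g · 1#) *ᶠ ((suc n !) · 1#) ⁻¹
      ≈⟨ *-congʳ (×1-homo-* N g) ⟨
    ((N ℕ.* g) · 1#) *ᶠ ((suc n !) · 1#) ⁻¹
      ≈⟨ *-congʳ (×-congˡ N*g≡) ⟩
    ((suc n !) · 1#) *ᶠ ((suc n !) · 1#) ⁻¹
      ≈⟨ *-inverseʳ (pos⇒≉0 (1·-pos (suc n !) {{suc n ℕ.!≢0}})) ⟩
    1# ∎)
    where
    N g : ℕ
    N = suc n ℕ.* (n C toℕ m)
    g = factorialWeight n (toℕ m)

    N*g≡ : N ℕ.* g ≡ suc n !
    N*g≡ = *-C*factorialWeight n (toℕ m) (ℕ.s≤s⁻¹ (Fin.toℕ<n m))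

  shapleyShubik-< : ∀ {N n} → N ≡ suc n → (G : SimpleGame N) → ∀ i j →
    weightedTotal N (criticalCount G j) (factorialWeight n) ℕ.<
    weightedTotal N (criticalCount G i) (factorialWeight n) →
    powerIndex K G (shapleyShubik K N) i >ᶠ powerIndex K G (shapleyShubik K N) j
  shapleyShubik-< {n = n} ≡.refl G =
    powerIndex-proportional G (factorialWeight n) (shapleyShubik K (suc n)) _
      (⁻¹-pos (1·-pos (suc n !) {{suc n ℕ.!≢0}})) (shapleyShubik-proportional n)

-- Sums over all coalitions

open import Data.Nat
  using (_+_; _*_; _≤_; _<_; _≤ᵇ_; _≟_; _≤?_; _<?_; s≤s⁻¹)
open import Data.Nat.Properties
open ≡ using (refl; sym; trans; cong; cong₂; subst; subst₂; module ≡-Reasoning)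
open CommutativeSemigroupProperties +-commutativeSemigroup using (interchange)

private variable
  a b : Level
  A B : Set a
  m n : ℕ

𝟙 : Dec A → ℕ
𝟙 A? = if does A? then 1 else 0

𝟙-cong : A ⇔ B → (A? : Dec A) (B? : Dec B) → 𝟙 A? ≡ 𝟙 B?
𝟙-cong A⇔B A? B? = cong (if_then 1 else 0) (does-⇔ A⇔B A? B?)

𝟙-yes : (A? : Dec A) → A → 𝟙 A? ≡ 1
𝟙-yes A? p = cong (if_then 1 else 0) (dec-true A? p)

𝟙-no : (A? : Dec A) → ¬ A → 𝟙 A? ≡ 0
𝟙-no A? ¬p = cong (if_then 1 else 0) (dec-false A? ¬p)

𝟙-mono : (A → B) → (A? : Dec A) (B? : Dec B) → 𝟙 A? ≤ 𝟙 B?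
𝟙-mono f (yes p) B? = ≤-reflexive (sym (𝟙-yes B? (f p)))
𝟙-mono f (no _)  B? = z≤n

𝟙-mono-< : (A? : Dec A) (B? : Dec B) → ¬ A → B → 𝟙 A? < 𝟙 B?
𝟙-mono-< A? B? ¬a b = subst₂ _<_ (sym (𝟙-no A? ¬a)) (sym (𝟙-yes B? b)) (s≤s z≤n)

-- Opaque, since unfolding Σˢ 537 would produce 2^537 summands.
opaque
  Σˢ : ∀ n → (Subset n → ℕ) → ℕ
  Σˢ zero    f = f []
  Σˢ (suc n) f = Σˢ n (λ T → f (inside ∷ T)) + Σˢ n (λ T → f (outside ∷ T))

opaque
  unfolding Σˢ

  Σˢ-∷ : ∀ n (f : Subset (suc n) → ℕ) →
         Σˢ (suc n) f ≡ Σˢ n (λ T → f (inside ∷ T)) + Σˢ n (λ T → f (outside ∷ T))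
  Σˢ-∷ n f = refl

  Σˢ-∷∷ : ∀ n (f : Subset (suc (suc n)) → ℕ) →
          Σˢ (suc (suc n)) f ≡
          (Σˢ n (λ T → f (inside ∷ inside ∷ T)) + Σˢ n (λ T → f (inside ∷ outside ∷ T))) +
          (Σˢ n (λ T → f (outside ∷ inside ∷ T)) + Σˢ n (λ T → f (outside ∷ outside ∷ T)))
  Σˢ-∷∷ n f = refl

  Σˢ-cong : ∀ n {f g : Subset n → ℕ} → (∀ T → f T ≡ g T) → Σˢ n f ≡ Σˢ n g
  Σˢ-cong zero    eq = eq []
  Σˢ-cong (suc n) eq = cong₂ _+_ (Σˢ-cong n (eq ∘ (inside ∷_))) (Σˢ-cong n (eq ∘ (outside ∷_)))

  Σˢ-mono-≤ : ∀ n {f g : Subset n → ℕ} → (∀ T → f T ≤ g T) → Σˢ n f ≤ Σˢ n g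
  Σˢ-mono-≤ zero    le = le []
  Σˢ-mono-≤ (suc n) le =
    +-mono-≤ (Σˢ-mono-≤ n (le ∘ (inside ∷_))) (Σˢ-mono-≤ n (le ∘ (outside ∷_)))

  Σˢ-mono-< : ∀ n {f g : Subset n → ℕ} → (∀ T → f T ≤ g T) →
              ∀ T → f T < g T → Σˢ n f < Σˢ n g
  Σˢ-mono-< zero    le []            lt = lt
  Σˢ-mono-< (suc n) le (inside ∷ T)  lt =
    +-mono-<-≤ (Σˢ-mono-< n (le ∘ (inside ∷_)) T lt) (Σˢ-mono-≤ n (le ∘ (outside ∷_)))
  Σˢ-mono-< (suc n) le (outside ∷ T) lt =
    +-mono-≤-< (Σˢ-mono-≤ n (le ∘ (inside ∷_))) (Σˢ-mono-< n (le ∘ (outside ∷_)) T lt)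

  Σˢ-zero : ∀ n {f : Subset n → ℕ} → (∀ T → f T ≡ 0) → Σˢ n f ≡ 0
  Σˢ-zero zero    eq = eq []
  Σˢ-zero (suc n) eq = cong₂ _+_ (Σˢ-zero n (eq ∘ (inside ∷_))) (Σˢ-zero n (eq ∘ (outside ∷_)))

  Σˢ-distrib-+ : ∀ n (f g : Subset n → ℕ) → Σˢ n (λ T → f T + g T) ≡ Σˢ n f + Σˢ n g
  Σˢ-distrib-+ zero    f g = refl
  Σˢ-distrib-+ (suc n) f g = trans
    (cong₂ _+_ (Σˢ-distrib-+ n (f ∘ (inside ∷_)) (g ∘ (inside ∷_)))
               (Σˢ-distrib-+ n (f ∘ (outside ∷_)) (g ∘ (outside ∷_))))
    (interchange (Σˢ n (f ∘ (inside ∷_))) _ _ _)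

  Σˢ-*ʳ : ∀ n (f : Subset n → ℕ) c → Σˢ n (λ T → f T * c) ≡ Σˢ n f * c
  Σˢ-*ʳ zero    f c = refl
  Σˢ-*ʳ (suc n) f c = trans
    (cong₂ _+_ (Σˢ-*ʳ n (f ∘ (inside ∷_)) c) (Σˢ-*ʳ n (f ∘ (outside ∷_)) c))
    (sym (*-distribʳ-+ c (Σˢ n (f ∘ (inside ∷_))) _))

  Σˢ-swap : ∀ m n (f : Subset m → Subset n → ℕ) →
            Σˢ m (λ T → Σˢ n (f T)) ≡ Σˢ n (λ U → Σˢ m (λ T → f T U))
  Σˢ-swap zero    n f = refl
  Σˢ-swap (suc m) n f = trans
    (cong₂ _+_ (Σˢ-swap m n (f ∘ (inside ∷_))) (Σˢ-swap m n (f ∘ (outside ∷_))))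
    (sym (Σˢ-distrib-+ n _ _))

  Σˢ-++ : ∀ m {n} (f : Subset (m + n) → ℕ) →
         Σˢ (m + n) f ≡ Σˢ m (λ T → Σˢ n (λ U → f (T ++ U)))
  Σˢ-++ zero    f = refl
  Σˢ-++ (suc m) f = cong₂ _+_ (Σˢ-++ m (f ∘ (inside ∷_))) (Σˢ-++ m (f ∘ (outside ∷_)))

  Σˢ-insertAt : ∀ n (i : Fin (suc n)) (f : Subset (suc n) → ℕ) →
                Σˢ (suc n) f ≡
                Σˢ n (λ T → f (insertAt T i inside)) + Σˢ n (λ T → f (insertAt T i outside))
  Σˢ-insertAt n       zero    f = refl
  Σˢ-insertAt (suc n) (suc i) f = trans
    (cong₂ _+_ (Σˢ-insertAt n i (f ∘ (inside ∷_))) (Σˢ-insertAt n i (f ∘ (outside ∷_))))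
    (interchange (Σˢ n (λ T → f (inside ∷ insertAt T i inside))) _ _ _)

length-filter-++ : {P : Pred A 0ℓ} (P? : Decidable P) (xs ys : List A) →
  length (filter P? (xs List.++ ys)) ≡ length (filter P? xs) + length (filter P? ys)
length-filter-++ P? xs ys =
  trans (cong length (List.filter-++ P? xs ys)) (List.length-++ (filter P? xs))

length-filter-map : {P : Pred B 0ℓ} (P? : Decidable P) (f : A → B) (xs : List A) →
  length (filter P? (List.map f xs)) ≡ length (filter (P? ∘ f) xs)
length-filter-map P? f []       = refl
length-filter-map P? f (x ∷ xs) with does (P? (f x))
... | true  = cong suc (length-filter-map P? f xs)
... | false = length-filter-map P? f xs

opaque
  unfolding Σˢ

  length-filter-subsets : ∀ n {P : Pred (Subset n) 0ℓ} (P? : Decidable P) →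
                          length (filter P? (subsets n)) ≡ Σˢ n (𝟙 ∘ P?)
  length-filter-subsets zero    P? with does (P? [])
  ... | true  = refl
  ... | false = refl
  length-filter-subsets (suc n) P? = trans
    (length-filter-++ P? (List.map (inside ∷_) (subsets n)) _)
    (cong₂ _+_ (block inside) (block outside))
    where
    block : ∀ x → length (filter P? (List.map (x ∷_) (subsets n))) ≡ Σˢ n (λ T → 𝟙 (P? (x ∷ T)))
    block x = trans (length-filter-map P? (x ∷_) (subsets n))
                    (length-filter-subsets n (P? ∘ (x ∷_)))

-- Inserting one player into a coalition

∣insertAt∣ : ∀ (T : Subset n) i → ∣ insertAt T i inside ∣ ≡ suc ∣ T ∣
∣insertAt∣ T             zero    = refl
∣insertAt∣ (inside  ∷ T) (suc i) = cong suc (∣insertAt∣ T i)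
∣insertAt∣ (outside ∷ T) (suc i) = ∣insertAt∣ T i

∣insertAt-out∣ : ∀ (T : Subset n) i → ∣ insertAt T i outside ∣ ≡ ∣ T ∣
∣insertAt-out∣ T             zero    = refl
∣insertAt-out∣ (inside  ∷ T) (suc i) = cong suc (∣insertAt-out∣ T i)
∣insertAt-out∣ (outside ∷ T) (suc i) = ∣insertAt-out∣ T i

∈-insertAt : ∀ (T : Subset n) i → i ∈ insertAt T i inside
∈-insertAt T       zero    = here
∈-insertAt (x ∷ T) (suc i) = there (∈-insertAt T i)

∉-insertAt : ∀ (T : Subset n) i → i ∉ insertAt T i outside
∉-insertAt T       zero    ()
∉-insertAt (x ∷ T) (suc i) (there i∈) = ∉-insertAt T i i∈

insertAt-remove : ∀ (T : Subset n) i x → insertAt T i x - i ≡ insertAt T i outside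
insertAt-remove T       zero    inside  = cong (outside ∷_) (p─⊥≡p T)
insertAt-remove T       zero    outside = cong (outside ∷_) (p─⊥≡p T)
insertAt-remove (y ∷ T) (suc i) x       = cong (y ∷_) (insertAt-remove T i x)

insertAt-⊆ : ∀ (T : Subset n) i → insertAt T i outside ⊆ insertAt T i inside
insertAt-⊆ T       zero    (there j∈) = there j∈
insertAt-⊆ (x ∷ T) (suc i) here       = here
insertAt-⊆ (x ∷ T) (suc i) (there j∈) = there (insertAt-⊆ T i j∈)

∣++∣ : ∀ (T : Subset m) (U : Subset n) → ∣ T ++ U ∣ ≡ ∣ T ∣ + ∣ U ∣
∣++∣ []            U = refl
∣++∣ (inside  ∷ T) U = cong suc (∣++∣ T U)
∣++∣ (outside ∷ T) U = ∣++∣ T U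

-- Pivotal players and the exchange of two players

module _ (G : SimpleGame (suc n)) where
  open SimpleGame G

  -- A coalition containing `i` is represented by its other members, so `i` leaves the index set of
  -- the sums and the size of the coalition becomes `suc ∣ T ∣`.
  Pivotal : Fin (suc n) → Pred (Subset n) 0ℓ
  Pivotal i T = Winning (insertAt T i inside) × ¬ Winning (insertAt T i outside)

  PivotalOfSize : Fin (suc n) → ℕ → Pred (Subset n) 0ℓ
  PivotalOfSize i k T = Pivotal i T × suc ∣ T ∣ ≡ k

  pivotalOfSize? : ∀ i k → Decidable (PivotalOfSize i k)
  pivotalOfSize? i k T =
    (winning? (insertAt T i inside) ×-dec ¬? (winning? (insertAt T i outside))) ×-dec (suc ∣ T ∣ ≟ k)

  criticalCount-Σˢ : ∀ i k → criticalCount G i k ≡ Σˢ n (𝟙 ∘ pivotalOfSize? i k)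
  criticalCount-Σˢ i k = begin
    criticalCount G i k
      ≡⟨ length-filter-subsets (suc n) critical ⟩
    Σˢ (suc n) (𝟙 ∘ critical)
      ≡⟨ Σˢ-insertAt n i (𝟙 ∘ critical) ⟩
    Σˢ n (λ T → 𝟙 (critical (insertAt T i inside))) +
    Σˢ n (λ T → 𝟙 (critical (insertAt T i outside)))
      ≡⟨ cong₂ _+_
           (Σˢ-cong n λ T → 𝟙-cong (with-i T) (critical (insertAt T i inside)) (pivotalOfSize? i k T))
           (Σˢ-zero n λ T → 𝟙-no (critical (insertAt T i outside))
             λ ((i∈ , _) , _) → ∉-insertAt T i i∈) ⟩
    Σˢ n (𝟙 ∘ pivotalOfSize? i k) + 0
      ≡⟨ +-identityʳ _ ⟩
    Σˢ n (𝟙 ∘ pivotalOfSize? i k) ∎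
    where
    open ≡-Reasoning

    critical : Decidable (λ T → Critical G i T × ∣ T ∣ ≡ k)
    critical T = critical? G i T ×-dec (∣ T ∣ ≟ k)

    with-i : ∀ T → (Critical G i (insertAt T i inside) × ∣ insertAt T i inside ∣ ≡ k) ⇔
                   PivotalOfSize i k T
    with-i T = mk⇔
      (λ ((_ , win , lose) , size) →
        (win , λ win′ → lose (subst Winning (sym (insertAt-remove T i inside)) win′)) ,
        trans (sym (∣insertAt∣ T i)) size)
      (λ ((win , lose) , size) →
        (∈-insertAt T i , win , λ win′ → lose (subst Winning (insertAt-remove T i inside) win′)) ,
        trans (∣insertAt∣ T i) size)

-- Swapping the two players turns every coalition in which suc j is critical
-- into one in which zero is, provided that zero can always replace suc j.
module _ (G : SimpleGame (suc (suc n))) (j : Fin (suc n))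
  (replace : ∀ T → SimpleGame.Winning G (outside ∷ insertAt T j inside) →
                   SimpleGame.Winning G (inside ∷ insertAt T j outside)) where
  open SimpleGame G

  Replaces : Pred (Subset n) 0ℓ
  Replaces T = Winning (inside ∷ insertAt T j outside) × ¬ Winning (outside ∷ insertAt T j inside)

  private
    first second : ℕ → Subset n → ℕ
    first  k T = 𝟙 (pivotalOfSize? G zero k (insertAt T j inside))
               + 𝟙 (pivotalOfSize? G zero k (insertAt T j outside))
    second k T = 𝟙 (pivotalOfSize? G (suc j) k (inside ∷ T))
               + 𝟙 (pivotalOfSize? G (suc j) k (outside ∷ T))

    first-Σˢ : ∀ k → criticalCount G zero k ≡ Σˢ n (first k)
    first-Σˢ k = trans (criticalCount-Σˢ G zero k)
      (trans (Σˢ-insertAt n j (𝟙 ∘ pivotalOfSize? G zero k)) (sym (Σˢ-distrib-+ n _ _)))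

    second-Σˢ : ∀ k → criticalCount G (suc j) k ≡ Σˢ n (second k)
    second-Σˢ k = trans (criticalCount-Σˢ G (suc j) k)
      (trans (Σˢ-∷ n (𝟙 ∘ pivotalOfSize? G (suc j) k)) (sym (Σˢ-distrib-+ n _ _)))

  module _ (k : ℕ) (T : Subset n) where
    private
      in-pivotal : PivotalOfSize G (suc j) k (inside ∷ T) →
        PivotalOfSize G zero k (insertAt T j inside)
      in-pivotal ((win , lose) , size) =
        -- If the coalition without `zero` were winning, `replace` would make the one without
        -- `suc j` winning, against `lose`.
        (win , lose ∘ replace T) , trans (cong suc (∣insertAt∣ T j)) size

      out-pivotal : PivotalOfSize G (suc j) k (outside ∷ T) →
        PivotalOfSize G zero k (insertAt T j outside)
      out-pivotal ((win , lose) , size) =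
        (replace T win , lose) , trans (cong suc (∣insertAt-out∣ T j)) size

      in-≤ : 𝟙 (pivotalOfSize? G (suc j) k (inside ∷ T)) ≤
        𝟙 (pivotalOfSize? G zero k (insertAt T j inside))
      in-≤ = 𝟙-mono in-pivotal
        (pivotalOfSize? G (suc j) k (inside ∷ T))
        (pivotalOfSize? G zero k (insertAt T j inside))

      out-≤ : 𝟙 (pivotalOfSize? G (suc j) k (outside ∷ T)) ≤
        𝟙 (pivotalOfSize? G zero k (insertAt T j outside))
      out-≤ = 𝟙-mono out-pivotal
        (pivotalOfSize? G (suc j) k (outside ∷ T))
        (pivotalOfSize? G zero k (insertAt T j outside))

    second≤first : second k T ≤ first k T
    second≤first = +-mono-≤ in-≤ out-≤

    -- If T wins with `zero` but loses with `suc j`, then `zero` is critical in T ∪ {zero} while T ∪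
    -- {suc j} is losing, and in T with both players only `zero` is critical. These coalitions have
    -- sizes ∣T∣ + 1 and ∣T∣ + 2, so one T gives strictness at two values of k.
    second<first : Replaces T → suc ∣ T ∣ ≡ k ⊎ suc (suc ∣ T ∣) ≡ k → second k T < first k T
    second<first (win , lose) (inj₁ size) = +-mono-≤-< in-≤ (𝟙-mono-<
      (pivotalOfSize? G (suc j) k (outside ∷ T)) (pivotalOfSize? G zero k (insertAt T j outside))
      (λ ((win′ , _) , _) → lose win′)
      ((win , λ win′ → lose (monotone (s⊆s (insertAt-⊆ T j)) win′)) ,
       trans (cong suc (∣insertAt-out∣ T j)) size))
    second<first (win , lose) (inj₂ size) = +-mono-<-≤ (𝟙-mono-<
      (pivotalOfSize? G (suc j) k (inside ∷ T)) (pivotalOfSize? G zero k (insertAt T j inside))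
      (λ ((_ , lose′) , _) → lose′ win)
      ((monotone (s⊆s (insertAt-⊆ T j)) win , lose) ,
       trans (cong suc (∣insertAt∣ T j)) size)) out-≤

  replace⇒≤ : ∀ k → criticalCount G (suc j) k ≤ criticalCount G zero k
  replace⇒≤ k = subst₂ _≤_ (sym (second-Σˢ k)) (sym (first-Σˢ k)) (Σˢ-mono-≤ n (second≤first k))

  replace⇒< : ∀ k T → Replaces T → suc ∣ T ∣ ≡ k ⊎ suc (suc ∣ T ∣) ≡ k →
              criticalCount G (suc j) k < criticalCount G zero k
  replace⇒< k T rep size = subst₂ _<_ (sym (second-Σˢ k)) (sym (first-Σˢ k))
    (Σˢ-mono-< n (second≤first k) T (second<first k T rep size))

-- Counting coalitions block by block

tailChoose : ℕ → ℕ → ℕ → ℕ → ℕ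
tailChoose n e β k = if e + β ≤ᵇ k then n C (k ∸ e) else 0

opaque
  unfolding Σˢ

  Σˢ-size : ∀ n k → Σˢ n (λ T → 𝟙 (∣ T ∣ ≟ k)) ≡ n C k
  Σˢ-size zero    zero    = refl
  Σˢ-size zero    (suc k) = refl
  Σˢ-size (suc n) zero    = trans
    (cong (_+ Σˢ n (λ T → 𝟙 (∣ T ∣ ≟ 0))) (Σˢ-zero n {λ T → 𝟙 (∣ inside ∷ T ∣ ≟ 0)} λ T → refl))
    (Σˢ-size n 0)
  Σˢ-size (suc n) (suc k) = trans (cong₂ _+_ (Σˢ-size n k) (Σˢ-size n (suc k)))
                                  (nCk+nC[k+1]≡[n+1]C[k+1] n k)

-- The size of T is forced to be k - e, so its lower bound β turns into a single test on k.
Σˢ-tail : ∀ n e β k → Σˢ n (λ T → 𝟙 ((β ≤? ∣ T ∣) ×-dec (e + ∣ T ∣ ≟ k))) ≡ tailChoose n e β k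
Σˢ-tail n e β k with e + β ≤ᵇ k in eq
... | true  = trans (Σˢ-cong n λ T → 𝟙-cong (mk⇔
                (λ (_ , size) → trans (sym (m+n∸m≡n e ∣ T ∣)) (cong (_∸ e) size))
                (λ size → let e+T≡k = trans (cong (e +_) size) (m+[n∸m]≡n (m+n≤o⇒m≤o e e+β≤k)) in
                  +-cancelˡ-≤ e β _ (≤-trans e+β≤k (≤-reflexive (sym e+T≡k))) , e+T≡k))
                ((β ≤? ∣ T ∣) ×-dec (e + ∣ T ∣ ≟ k)) (∣ T ∣ ≟ k ∸ e))
              (Σˢ-size n (k ∸ e))
  where
  e+β≤k : e + β ≤ k
  e+β≤k = ≤ᵇ⇒≤ (e + β) k (subst Bool.T (sym eq) _)
... | false = Σˢ-zero n λ T → 𝟙-no ((β ≤? ∣ T ∣) ×-dec (e + ∣ T ∣ ≟ k)) λ (β≤ , size) →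
                subst Bool.T eq (≤⇒≤ᵇ (≤-trans (+-monoʳ-≤ e β≤) (≤-reflexive size)))

-- Opaque, since (m C θ) * x unfolds to m C θ copies of x.
opaque
  exactTail : ℕ → ℕ → ℕ → ℕ → ℕ → ℕ → ℕ
  exactTail m θ n e β k = (m C θ) * tailChoose n e β k

  exactTail-≡ : ∀ m θ n e β k → exactTail m θ n e β k ≡ (m C θ) * tailChoose n e β k
  exactTail-≡ m θ n e β k = refl

-- Once ∣T∣ is fixed at θ, the sum over U no longer depends on T, and the double sum factors.
Σˢ-exact-tail : ∀ m n d θ β k →
  Σˢ m (λ T → Σˢ n λ U → 𝟙 (((∣ T ∣ ≟ θ) ×-dec (β ≤? ∣ U ∣)) ×-dec (d + (∣ T ∣ + ∣ U ∣) ≟ k)))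
  ≡ (m C θ) * tailChoose n (d + θ) β k
Σˢ-exact-tail m n d θ β k = begin
  Σˢ m (λ T → Σˢ n λ U → 𝟙 (((∣ T ∣ ≟ θ) ×-dec (β ≤? ∣ U ∣)) ×-dec (d + (∣ T ∣ + ∣ U ∣) ≟ k)))
    ≡⟨ Σˢ-cong m block ⟩
  Σˢ m (λ T → 𝟙 (∣ T ∣ ≟ θ) * tailChoose n (d + θ) β k)
    ≡⟨ Σˢ-*ʳ m (λ T → 𝟙 (∣ T ∣ ≟ θ)) _ ⟩
  Σˢ m (λ T → 𝟙 (∣ T ∣ ≟ θ)) * tailChoose n (d + θ) β k
    ≡⟨ cong (_* tailChoose n (d + θ) β k) (Σˢ-size m θ) ⟩
  (m C θ) * tailChoose n (d + θ) β k ∎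
  where
  open ≡-Reasoning

  block : ∀ T → Σˢ n (λ U → 𝟙 (((∣ T ∣ ≟ θ) ×-dec (β ≤? ∣ U ∣)) ×-dec (d + (∣ T ∣ + ∣ U ∣) ≟ k)))
              ≡ 𝟙 (∣ T ∣ ≟ θ) * tailChoose n (d + θ) β k
  block T = by (∣ T ∣ ≟ θ)
    where
    body : ∀ U → Dec ((∣ T ∣ ≡ θ × β ≤ ∣ U ∣) × d + (∣ T ∣ + ∣ U ∣) ≡ k)
    body U = ((∣ T ∣ ≟ θ) ×-dec (β ≤? ∣ U ∣)) ×-dec (d + (∣ T ∣ + ∣ U ∣) ≟ k)

    by : Dec (∣ T ∣ ≡ θ) → Σˢ n (𝟙 ∘ body) ≡ 𝟙 (∣ T ∣ ≟ θ) * tailChoose n (d + θ) β k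
    by (yes T≡θ) = begin
      Σˢ n (𝟙 ∘ body)
        ≡⟨ Σˢ-cong n (λ U → 𝟙-cong (mk⇔
             (λ ((_ , β≤) , size) → β≤ , trans (sym (regroup U)) size)
             (λ (β≤ , size) → (T≡θ , β≤) , trans (regroup U) size))
             (body U) ((β ≤? ∣ U ∣) ×-dec (d + θ + ∣ U ∣ ≟ k))) ⟩
      Σˢ n (λ U → 𝟙 ((β ≤? ∣ U ∣) ×-dec (d + θ + ∣ U ∣ ≟ k)))
        ≡⟨ Σˢ-tail n (d + θ) β k ⟩
      tailChoose n (d + θ) β k
        ≡⟨ *-identityˡ _ ⟨
      1 * tailChoose n (d + θ) β k
        ≡⟨ cong (_* tailChoose n (d + θ) β k) (𝟙-yes (∣ T ∣ ≟ θ) T≡θ) ⟨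
      𝟙 (∣ T ∣ ≟ θ) * tailChoose n (d + θ) β k ∎
      where
      regroup : ∀ U → d + (∣ T ∣ + ∣ U ∣) ≡ d + θ + ∣ U ∣
      regroup U = trans (cong (λ t → d + (t + ∣ U ∣)) T≡θ) (sym (+-assoc d θ ∣ U ∣))
    by (no T≢θ) = trans
      (Σˢ-zero n λ U → 𝟙-no (body U) λ ((T≡θ , _) , _) → T≢θ T≡θ)
      (cong (_* tailChoose n (d + θ) β k) (sym (𝟙-no (∣ T ∣ ≟ θ) T≢θ)))

Σˢ-++-exact-tail : ∀ m n {P : Pred (Subset (m + n)) 0ℓ} (P? : Decidable P) d θ β k →
  (∀ T U → P (T ++ U) ⇔ ((∣ T ∣ ≡ θ × β ≤ ∣ U ∣) × d + (∣ T ∣ + ∣ U ∣) ≡ k)) →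
  Σˢ (m + n) (𝟙 ∘ P?) ≡ exactTail m θ n (d + θ) β k
Σˢ-++-exact-tail m n P? d θ β k P⇔ = trans (Σˢ-++ m (𝟙 ∘ P?)) (trans
  (Σˢ-cong m λ T → Σˢ-cong n λ U → 𝟙-cong (P⇔ T U) (P? (T ++ U))
    (((∣ T ∣ ≟ θ) ×-dec (β ≤? ∣ U ∣)) ×-dec (d + (∣ T ∣ + ∣ U ∣) ≟ k)))
  (trans (Σˢ-exact-tail m n d θ β k) (sym (exactTail-≡ m θ n (d + θ) β k))))

-- For a representative the exact quota sits in the second block, so the order of summation is
-- exchanged first.
Σˢ-++-tail-exact : ∀ m n {P : Pred (Subset (m + n)) 0ℓ} (P? : Decidable P) d θ β k →
  (∀ T U → P (T ++ U) ⇔ ((∣ U ∣ ≡ θ × β ≤ ∣ T ∣) × d + (∣ U ∣ + ∣ T ∣) ≡ k)) →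
  Σˢ (m + n) (𝟙 ∘ P?) ≡ exactTail n θ m (d + θ) β k
Σˢ-++-tail-exact m n P? d θ β k P⇔ = trans (Σˢ-++ m (𝟙 ∘ P?)) (trans
  (Σˢ-swap m n λ T U → 𝟙 (P? (T ++ U))) (trans
  (Σˢ-cong n λ U → Σˢ-cong m λ T → 𝟙-cong (P⇔ T U) (P? (T ++ U))
    (((∣ U ∣ ≟ θ) ×-dec (β ≤? ∣ T ∣)) ×-dec (d + (∣ U ∣ + ∣ T ∣) ≟ k)))
  (trans (Σˢ-exact-tail n m d θ β k) (sym (exactTail-≡ n θ m (d + θ) β k)))))

-- Subsets of prescribed size and concatenated blocks

chooseSubset : ∀ (T : Subset n) k → k ≤ ∣ T ∣ → ∃[ U ] (U ⊆ T × ∣ U ∣ ≡ k)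
chooseSubset []            zero    _ = [] , ⊆-refl , refl
chooseSubset (inside ∷ T)  zero    _ =
  let U , U⊆T , size = chooseSubset T zero z≤n in outside ∷ U , (λ { (there i∈) → there (U⊆T i∈) }) , size
chooseSubset (inside ∷ T)  (suc k) k≤ =
  let U , U⊆T , size = chooseSubset T k (s≤s⁻¹ k≤) in inside ∷ U , s⊆s U⊆T , cong suc size
chooseSubset (outside ∷ T) k       k≤ =
  let U , U⊆T , size = chooseSubset T k k≤ in outside ∷ U , s⊆s U⊆T , size

subsetOfSize : ∀ n k → k ≤ n → ∃[ U ] ∣ U ∣ ≡ k
subsetOfSize n k k≤n =
  let U , _ , size = chooseSubset (⊤ {n}) k (≤-trans k≤n (≤-reflexive (sym (∣⊤∣≡n n)))) in U , size

++-mono-⊆ : ∀ {T T′ : Subset m} {U U′ : Subset n} → T ⊆ T′ → U ⊆ U′ → T ++ U ⊆ T′ ++ U′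
++-mono-⊆ {T = []}    {[]}     _    U⊆U′ = U⊆U′
++-mono-⊆ {T = x ∷ T} {y ∷ T′} T⊆T′ U⊆U′ here       with T⊆T′ here
... | here = here
++-mono-⊆ {T = x ∷ T} {y ∷ T′} T⊆T′ U⊆U′ (there i∈) =
  there (++-mono-⊆ (drop-∷-⊆ T⊆T′) U⊆U′ i∈)

∣++∩⊤++⊥∣ : ∀ (T : Subset m) (U : Subset n) → ∣ (T ++ U) ∩ (⊤ {m} ++ ⊥ {n}) ∣ ≡ ∣ T ∣
∣++∩⊤++⊥∣ {n = n} []  U = trans (cong ∣_∣ (∩-zeroʳ U)) (∣⊥∣≡0 n)
∣++∩⊤++⊥∣ (inside  ∷ T) U = cong suc (∣++∩⊤++⊥∣ T U)
∣++∩⊤++⊥∣ (outside ∷ T) U = ∣++∩⊤++⊥∣ T U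

∣++∩⊥++⊤∣ : ∀ (T : Subset m) (U : Subset n) → ∣ (T ++ U) ∩ (⊥ {m} ++ ⊤ {n}) ∣ ≡ ∣ U ∣
∣++∩⊥++⊤∣ []            U = cong ∣_∣ (∩-identityʳ U)
∣++∩⊥++⊤∣ (inside  ∷ T) U = ∣++∩⊥++⊤∣ T U
∣++∩⊥++⊤∣ (outside ∷ T) U = ∣++∩⊥++⊤∣ T U

⊤++⊥∪⊥++⊤≡⊤ : ∀ m n → (⊤ {m} ++ ⊥ {n}) ∪ (⊥ {m} ++ ⊤ {n}) ≡ ⊤ {m + n}
⊤++⊥∪⊥++⊤≡⊤ zero    n = ∪-identityˡ ⊤
⊤++⊥∪⊥++⊤≡⊤ (suc m) n = cong (inside ∷_) (⊤++⊥∪⊥++⊤≡⊤ m n)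

insertAt-++ˡ : ∀ (T : Subset m) (U : Subset n) (i : Fin (suc m)) x →
               insertAt (T ++ U) (i ↑ˡ n) x ≡ insertAt T i x ++ U
insertAt-++ˡ T       U zero    x = refl
insertAt-++ˡ (y ∷ T) U (suc i) x = cong (y ∷_) (insertAt-++ˡ T U i x)

-- `m + suc n` and `suc (m + n)` differ for a variable `m`, hence the `cast` and a position given by
-- its value. For 100 and 434 they are the same numeral, and the cast disappears.
insertAt-++ʳ : ∀ (T : Subset m) (U : Subset n) (i : Fin (suc (m + n))) (j : Fin (suc n)) x →
               toℕ i ≡ m + toℕ j → .(eq : m + suc n ≡ suc (m + n)) →
               insertAt (T ++ U) i x ≡ cast eq (T ++ insertAt U j x)
insertAt-++ʳ []      U i       j x i≡j eq =
  trans (cong (λ i → insertAt U i x) (Fin.toℕ-injective i≡j)) (sym (cast-is-id eq _))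
insertAt-++ʳ (y ∷ T) U (suc i) j x i≡j eq =
  cong (y ∷_) (insertAt-++ʳ T U i j x (suc-injective i≡j) (suc-injective eq))

-- The other chamber's condition `Y` is the same on both sides, so being critical means missing the
-- quota by exactly one.
threshold : ∀ q x {Y : Set} → ((q ≤ suc x × Y) × ¬ (q ≤ x × Y)) ⇔ (suc x ≡ q × Y)
threshold q x = mk⇔
  (λ ((q≤1+x , y) , ¬q≤x) → ≤-antisym (≰⇒> λ q≤x → ¬q≤x (q≤x , y)) q≤1+x , y)
  (λ { (refl , y) → (≤-refl , y) , λ (q≤x , _) → 1+n≰n q≤x })

-- Wins p f s r: f counts the members of the full Senate and s the senators.
Wins : Bool → ℕ → ℕ → ℕ → Set
Wins true  f s r = 51 ≤ f × 218 ≤ r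
Wins false f s r = 67 ≤ s × 290 ≤ r

-- Chamber sizes of a coalition

module _ (A : Subset 100) (B : Subset 435) where
  private
    coalition : Bool → Bool → Subset 537
    coalition p v = p ∷ v ∷ (A ++ B)

  -- Split into four clauses because the intersection reduces only once both leading bits are known.
  ∣∩senators∣ : ∀ p v → ∣ coalition p v ∩ senators ∣ ≡ ∣ A ∣
  ∣∩senators∣ true  true  = ∣++∩⊤++⊥∣ A B
  ∣∩senators∣ true  false = ∣++∩⊤++⊥∣ A B
  ∣∩senators∣ false true  = ∣++∩⊤++⊥∣ A B
  ∣∩senators∣ false false = ∣++∩⊤++⊥∣ A B

  ∣∩representatives∣ : ∀ p v → ∣ coalition p v ∩ representatives ∣ ≡ ∣ B ∣
  ∣∩representatives∣ true  true  = ∣++∩⊥++⊤∣ A B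
  ∣∩representatives∣ true  false = ∣++∩⊥++⊤∣ A B
  ∣∩representatives∣ false true  = ∣++∩⊥++⊤∣ A B
  ∣∩representatives∣ false false = ∣++∩⊥++⊤∣ A B

  private
    full : ∣ (A ++ B) ∩ ((⊤ {100} ++ ⊥ {435}) ∪ ⊥) ∣ ≡ ∣ A ∣
    full = trans (cong (λ S → ∣ (A ++ B) ∩ S ∣) (∪-identityʳ (⊤ {100} ++ ⊥ {435}))) (∣++∩⊤++⊥∣ A B)

  ∣∩fullSenate∣ : ∀ p v → ∣ coalition p v ∩ fullSenate ∣ ≡ ∣ v ∷ A ∣
  ∣∩fullSenate∣ true  true  = cong suc full
  ∣∩fullSenate∣ true  false = full
  ∣∩fullSenate∣ false true  = cong suc full
  ∣∩fullSenate∣ false false = full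

∣∩∣-mono : ∀ {T U : Subset n} → T ⊆ U → ∀ V → ∣ T ∩ V ∣ ≤ ∣ U ∩ V ∣
∣∩∣-mono {T = T} {U} T⊆U V = p⊆q⇒∣p∣≤∣q∣ λ i∈ →
  let i∈T , i∈V = x∈p∩q⁻ T V i∈ in x∈p∩q⁺ (T⊆U i∈T , i∈V)

suc≡⇔ : ∀ {a b} → (suc a ≡ suc b) ⇔ (a ≡ b)
suc≡⇔ = mk⇔ suc-injective (cong suc)

×-comm⇔ : ∀ {A B : Set} → (A × B) ⇔ (B × A)
×-comm⇔ = mk⇔ swap swap

s≤s⇔ : ∀ {a b} → (suc a ≤ suc b) ⇔ (a ≤ b)
s≤s⇔ = mk⇔ s≤s⁻¹ s≤s

∣∷insertAt∣ : ∀ v (A : Subset n) s → ∣ v ∷ insertAt A s inside ∣ ≡ suc ∣ v ∷ A ∣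
∣∷insertAt∣ v A s = ∣insertAt∣ (v ∷ A) (suc s)

∣∷insertAt-out∣ : ∀ v (A : Subset n) s → ∣ v ∷ insertAt A s outside ∣ ≡ ∣ v ∷ A ∣
∣∷insertAt-out∣ v A s = ∣insertAt-out∣ (v ∷ A) (suc s)

size⇔ : ∀ d {k} (A : Subset m) (B : Subset n) → (d + ∣ A ++ B ∣ ≡ k) ⇔ (d + (∣ A ∣ + ∣ B ∣) ≡ k)
size⇔ d {k} A B = ≡⇒ {k = equivalence} (cong (λ c → d + c ≡ k) (∣++∣ A B))

size⇔′ : ∀ d {k} (A : Subset m) (B : Subset n) → (d + ∣ A ++ B ∣ ≡ k) ⇔ (d + (∣ B ∣ + ∣ A ∣) ≡ k)
size⇔′ d {k} A B = ≡⇒ {k = equivalence} (cong (λ c → d + c ≡ k) (trans (∣++∣ A B) (+-comm (∣ A ∣) (∣ B ∣))))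

threshold′ : ∀ q x {Y : Set} → ((Y × q ≤ suc x) × ¬ (Y × q ≤ x)) ⇔ (suc x ≡ q × Y)
threshold′ q x = ⇔.trans (×-comm⇔ ×-⇔ ¬-cong-⇔ ×-comm⇔) (threshold q x)

-- The summands belong to the coalitions containing both the president and the
-- vice president, only the president, only the vice president, and neither.
senatorCount representativeCount vicePresidentCount : ℕ → ℕ
senatorCount k =
  (exactTail 99 49 435 52 218 k + exactTail 99 50 435 52 218 k) +
  (exactTail 99 66 435 68 290 k + exactTail 99 66 435 67 290 k)
representativeCount k =
  (exactTail 434 217 100 220 50 k + exactTail 434 217 100 219 51 k) +
  (exactTail 434 289 100 291 67 k + exactTail 434 289 100 290 67 k)
vicePresidentCount k = exactTail 100 50 435 52 218 k

-- Numerical comparison of the closed forms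

opaque
  unfolding exactTail weightedTotal

  -- Evaluated at every size from 0 to 537. R is critical only at sizes 270 to 320 and 357 to 391, S
  -- at all sizes from 270 to 503. The margin is thin at 270, where cancelling common factors leaves
  -- 435/218 > 101/51.
  senatorCount-≻-representativeCount-Fin : ∀ (i : Fin 538) → let k = toℕ i in
    representativeCount k < senatorCount k ⊎ (senatorCount k ≡ 0 × representativeCount k ≡ 0)
  senatorCount-≻-representativeCount-Fin = toWitness
    {a? = Fin.all? λ i → (representativeCount (toℕ i) <? senatorCount (toℕ i)) ⊎-dec
                         ((senatorCount (toℕ i) ≟ 0) ×-dec (representativeCount (toℕ i) ≟ 0))} tt

  -- By Pascal's rule C(99, 49) + C(99, 50) = C(100, 50), the two summands of `senatorCount` with
  -- the president add up to `vicePresidentCount`; the excess comes from the coalitions without him.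
  vicePresidentCount≤senatorCount-Fin : ∀ (i : Fin 538) →
    vicePresidentCount (toℕ i) ≤ senatorCount (toℕ i)
  vicePresidentCount≤senatorCount-Fin = toWitness
    {a? = Fin.all? λ i → vicePresidentCount (toℕ i) ≤? senatorCount (toℕ i)} tt

  representativeTotal<vicePresidentTotal :
    weightedTotal 537 representativeCount (λ _ → 1) < weightedTotal 537 vicePresidentCount (λ _ → 1)
  representativeTotal<vicePresidentTotal = <ᵇ⇒< _ _ tt

  vicePresidentTotal<senatorTotal :
    weightedTotal 537 vicePresidentCount (λ _ → 1) < weightedTotal 537 senatorCount (λ _ → 1)
  vicePresidentTotal<senatorTotal = <ᵇ⇒< _ _ tt

  representativeFactorialTotal<vicePresidentFactorialTotal :
    weightedTotal 537 representativeCount (factorialWeight 536) <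
    weightedTotal 537 vicePresidentCount (factorialWeight 536)
  representativeFactorialTotal<vicePresidentFactorialTotal = <ᵇ⇒< _ _ tt

  vicePresidentFactorialTotal<senatorFactorialTotal :
    weightedTotal 537 vicePresidentCount (factorialWeight 536) <
    weightedTotal 537 senatorCount (factorialWeight 536)
  vicePresidentFactorialTotal<senatorFactorialTotal = <ᵇ⇒< _ _ tt

upTo537 : (P : ℕ → Set) → (∀ (i : Fin 538) → P (toℕ i)) → ∀ k → k ≤ 537 → P k
upTo537 P p k k≤537 = subst P (Fin.toℕ-fromℕ< (s≤s k≤537)) (p (fromℕ< (s≤s k≤537)))

senatorCount-≻-representativeCount : ∀ k → k ≤ 537 →
  ¬ (senatorCount k ≡ 0 × representativeCount k ≡ 0) → representativeCount k < senatorCount k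
senatorCount-≻-representativeCount k k≤537 ¬both =
  [ id , (λ both → contradiction both ¬both) ]′
    (upTo537 (λ k → representativeCount k < senatorCount k ⊎ (senatorCount k ≡ 0 × representativeCount k ≡ 0))
       senatorCount-≻-representativeCount-Fin k k≤537)

vicePresidentCount≤senatorCount : ∀ k → k ≤ 537 → vicePresidentCount k ≤ senatorCount k
vicePresidentCount≤senatorCount =
  upTo537 (λ k → vicePresidentCount k ≤ senatorCount k) vicePresidentCount≤senatorCount-Fin

-- Stated for any game with these winning coalitions, so that the decision
-- procedure of usLegislature is never evaluated.
module _ (G : SimpleGame 537)
  (winning⇔ : ∀ p v (A : Subset 100) (B : Subset 435) →
              SimpleGame.Winning G (p ∷ v ∷ (A ++ B)) ⇔
              Wins p (∣ v ∷ A ∣) (∣ A ∣) (∣ B ∣)) where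
  open SimpleGame G using (Winning)

  -- Critical counts of senator, representative and vice president

  winning-senator⇔ : ∀ s p v x (A : Subset 99) (B : Subset 435) →
    Winning (insertAt (p ∷ v ∷ (A ++ B)) (senator s) x)
    ⇔ Wins p (∣ v ∷ insertAt A s x ∣) (∣ insertAt A s x ∣) (∣ B ∣)
  winning-senator⇔ s p v x A B =
    subst (λ T → Winning (p ∷ v ∷ T) ⇔ Wins p (∣ v ∷ insertAt A s x ∣) (∣ insertAt A s x ∣) (∣ B ∣))
          (sym (insertAt-++ˡ A B s x)) (winning⇔ p v (insertAt A s x) B)

  winning-representative⇔ : ∀ r p v x (A : Subset 100) (B : Subset 434) →
    Winning (insertAt (p ∷ v ∷ (A ++ B)) (representative r) x)
    ⇔ Wins p (∣ v ∷ A ∣) (∣ A ∣) (∣ insertAt B r x ∣)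
  winning-representative⇔ r p v x A B =
    subst (λ T → Winning (p ∷ v ∷ T) ⇔ Wins p (∣ v ∷ A ∣) (∣ A ∣) (∣ insertAt B r x ∣))
          (sym (trans (insertAt-++ʳ A B (100 ↑ʳ r) r x (Fin.toℕ-↑ʳ 100 r) refl) (cast-is-id refl _)))
          (winning⇔ p v A (insertAt B r x))

  pivotal-senator⇔ : ∀ s p v (A : Subset 99) (B : Subset 435) →
    Pivotal G (senator s) (p ∷ v ∷ (A ++ B)) ⇔
    (Wins p (suc ∣ v ∷ A ∣) (suc ∣ A ∣) (∣ B ∣) × ¬ Wins p (∣ v ∷ A ∣) (∣ A ∣) (∣ B ∣))
  pivotal-senator⇔ s p v A B =
    ⇔.trans (winning-senator⇔ s p v inside A B)
      (≡⇒ {k = equivalence} (cong₂ (λ f s → Wins p f s (∣ B ∣)) (∣∷insertAt∣ v A s) (∣insertAt∣ A s)))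
    ×-⇔ ¬-cong-⇔ (⇔.trans (winning-senator⇔ s p v outside A B)
      (≡⇒ {k = equivalence} (cong₂ (λ f s → Wins p f s (∣ B ∣)) (∣∷insertAt-out∣ v A s) (∣insertAt-out∣ A s))))

  pivotal-representative⇔ : ∀ r p v (A : Subset 100) (B : Subset 434) →
    Pivotal G (representative r) (p ∷ v ∷ (A ++ B)) ⇔
    (Wins p (∣ v ∷ A ∣) (∣ A ∣) (suc ∣ B ∣) × ¬ Wins p (∣ v ∷ A ∣) (∣ A ∣) (∣ B ∣))
  pivotal-representative⇔ r p v A B =
    ⇔.trans (winning-representative⇔ r p v inside A B)
      (≡⇒ {k = equivalence} (cong (Wins p (∣ v ∷ A ∣) (∣ A ∣)) (∣insertAt∣ B r)))
    ×-⇔ ¬-cong-⇔ (⇔.trans (winning-representative⇔ r p v outside A B)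
      (≡⇒ {k = equivalence} (cong (Wins p (∣ v ∷ A ∣) (∣ A ∣)) (∣insertAt-out∣ B r))))

  -- Beside P the quota 51 leaves 49 other senators if V is present and 50 if not; without P the
  -- quota 67 leaves 66, and V only adds to the size. The offsets 3, 2, 2, 1 count S together with P
  -- and V where present.
  criticalCount-senator : ∀ s k → criticalCount G (senator s) k ≡ senatorCount k
  criticalCount-senator s k = trans (criticalCount-Σˢ G (senator s) k) (trans
    (Σˢ-∷∷ 534 (𝟙 ∘ pivotal?)) (cong₂ _+_
    (cong₂ _+_
      (Σˢ-++-exact-tail 99 435 (λ T → pivotal? (true ∷ true ∷ T)) 3 49 218 k λ A B →
        ⇔.trans (pivotal-senator⇔ s true true A B)
          (⇔.trans (threshold 51 (suc ∣ A ∣)) (⇔.trans suc≡⇔ suc≡⇔ ×-⇔ ⇔.refl)) ×-⇔ size⇔ 3 A B)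
      (Σˢ-++-exact-tail 99 435 (λ T → pivotal? (true ∷ false ∷ T)) 2 50 218 k λ A B →
        ⇔.trans (pivotal-senator⇔ s true false A B)
          (⇔.trans (threshold 51 ∣ A ∣) (suc≡⇔ ×-⇔ ⇔.refl)) ×-⇔ size⇔ 2 A B))
    (cong₂ _+_
      (Σˢ-++-exact-tail 99 435 (λ T → pivotal? (false ∷ true ∷ T)) 2 66 290 k λ A B →
        ⇔.trans (pivotal-senator⇔ s false true A B)
          (⇔.trans (threshold 67 ∣ A ∣) (suc≡⇔ ×-⇔ ⇔.refl)) ×-⇔ size⇔ 2 A B)
      (Σˢ-++-exact-tail 99 435 (λ T → pivotal? (false ∷ false ∷ T)) 1 66 290 k λ A B →
        ⇔.trans (pivotal-senator⇔ s false false A B)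
          (⇔.trans (threshold 67 ∣ A ∣) (suc≡⇔ ×-⇔ ⇔.refl)) ×-⇔ size⇔ 1 A B))))
    where
    pivotal? : Decidable (PivotalOfSize G (senator s) k)
    pivotal? = pivotalOfSize? G (senator s) k

  criticalCount-representative : ∀ r k →
    criticalCount G (representative r) k ≡ representativeCount k
  criticalCount-representative r k = trans (criticalCount-Σˢ G (representative r) k) (trans
    (Σˢ-∷∷ 534 (𝟙 ∘ pivotal?)) (cong₂ _+_
    (cong₂ _+_
      (Σˢ-++-tail-exact 100 434 (λ T → pivotal? (true ∷ true ∷ T)) 3 217 50 k λ A B →
        ⇔.trans (pivotal-representative⇔ r true true A B)
          -- V supplies one of the 51 members of the full Senate, so only 50 senators are required.
          (⇔.trans (threshold′ 218 ∣ B ∣) (suc≡⇔ ×-⇔ s≤s⇔)) ×-⇔ size⇔′ 3 A B)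
      (Σˢ-++-tail-exact 100 434 (λ T → pivotal? (true ∷ false ∷ T)) 2 217 51 k λ A B →
        ⇔.trans (pivotal-representative⇔ r true false A B)
          (⇔.trans (threshold′ 218 ∣ B ∣) (suc≡⇔ ×-⇔ ⇔.refl)) ×-⇔ size⇔′ 2 A B))
    (cong₂ _+_
      (Σˢ-++-tail-exact 100 434 (λ T → pivotal? (false ∷ true ∷ T)) 2 289 67 k λ A B →
        ⇔.trans (pivotal-representative⇔ r false true A B)
          (⇔.trans (threshold′ 290 ∣ B ∣) (suc≡⇔ ×-⇔ ⇔.refl)) ×-⇔ size⇔′ 2 A B)
      (Σˢ-++-tail-exact 100 434 (λ T → pivotal? (false ∷ false ∷ T)) 1 289 67 k λ A B →
        ⇔.trans (pivotal-representative⇔ r false false A B)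
          (⇔.trans (threshold′ 290 ∣ B ∣) (suc≡⇔ ×-⇔ ⇔.refl)) ×-⇔ size⇔′ 1 A B))))
    where
    pivotal? : Decidable (PivotalOfSize G (representative r) k)
    pivotal? = pivotalOfSize? G (representative r) k

  criticalCount-vicePresident : ∀ k → criticalCount G vicePresident k ≡ vicePresidentCount k
  criticalCount-vicePresident k = trans (criticalCount-Σˢ G vicePresident k) (trans
    (Σˢ-∷ 535 (𝟙 ∘ pivotal?)) (trans (cong₂ _+_
    (Σˢ-++-exact-tail 100 435 (λ T → pivotal? (true ∷ T)) 2 50 218 k λ A B →
      ⇔.trans (winning⇔ true true A B ×-⇔ ¬-cong-⇔ (winning⇔ true false A B))
        (⇔.trans (threshold 51 ∣ A ∣) (suc≡⇔ ×-⇔ ⇔.refl)) ×-⇔ size⇔ 2 A B)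
    -- Without P a coalition wins by its senators and representatives alone, so V is never critical.
    (trans (Σˢ-++ 100 (λ T → 𝟙 (pivotal? (false ∷ T))))
      (Σˢ-zero 100 λ A → Σˢ-zero 435 λ B → 𝟙-no (pivotal? (false ∷ (A ++ B)))
        λ ((win , lose) , _) → lose (Equivalence.from (winning⇔ false false A B)
                                       (Equivalence.to (winning⇔ false true A B) win)))))
    (+-identityʳ _)))
    where
    pivotal? : Decidable (PivotalOfSize G vicePresident k)
    pivotal? = pivotalOfSize? G vicePresident k

  -- President against senator

  pivotal-president⇔ : ∀ v (A : Subset 100) (B : Subset 435) →
    Pivotal G president (v ∷ (A ++ B)) ⇔
    (Wins true (∣ v ∷ A ∣) (∣ A ∣) (∣ B ∣) × ¬ Wins false (∣ v ∷ A ∣) (∣ A ∣) (∣ B ∣))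
  pivotal-president⇔ v A B = winning⇔ true v A B ×-⇔ ¬-cong-⇔ (winning⇔ false v A B)

  -- 270 = 1 + 51 + 218 and 503 = 1 + 1 + 66 + 435.
  criticalCount-president≡0 : ∀ k → k < 270 ⊎ 503 < k → criticalCount G president k ≡ 0
  criticalCount-president≡0 k k-out = trans (criticalCount-Σˢ G president k)
    (Σˢ-zero 536 λ T → 𝟙-no (pivotalOfSize? G president k T) (outOfRange T))
    where
    outOfRange : ∀ T → ¬ PivotalOfSize G president k T
    outOfRange (v ∷ T) (piv , size) with splitAt 100 T
    ... | A , B , refl with Equivalence.to (pivotal-president⇔ v A B) piv
    ... | (f , r) , lose = [ (λ k<270 → <⇒≱ k<270 lower) , (λ 503<k → <⇒≱ 503<k upper) ]′ k-out
      where
      size′ : suc (∣ v ∷ A ∣ + ∣ B ∣) ≡ k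
      size′ = trans (cong suc (sym (∣++∣ (v ∷ A) B))) size

      lower : 270 ≤ k
      lower = ≤-trans (s≤s (+-mono-≤ f r)) (≤-reflexive size′)

      upper : k ≤ 503
      upper with 67 ≤? ∣ A ∣
      -- With 67 senators present the coalition without P loses only if it has at most 289
      -- representatives, and 1 + 101 + 289 = 391.
      ... | yes s = ≤-trans (≤-reflexive (sym size′))
        (≤-trans (s≤s (+-mono-≤ (∣p∣≤n (v ∷ A)) (s≤s⁻¹ (≰⇒> λ r′ → lose (s , r′))))) (≤ᵇ⇒≤ 391 503 tt))
      ... | no ¬s = ≤-trans (≤-reflexive (sym size′))
        (s≤s (+-mono-≤ (≤-trans (∣∷∣≤ v A) (≰⇒> ¬s)) (∣p∣≤n B)))
        where
        ∣∷∣≤ : ∀ {n} v (A : Subset n) → ∣ v ∷ A ∣ ≤ suc ∣ A ∣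
        ∣∷∣≤ true  A = ≤-refl
        ∣∷∣≤ false A = n≤1+n _

  -- A winning coalition without P has 67 senators and 290 representatives. Dropping S leaves 66 ≥
  -- 51 senators, and 290 ≥ 218, so adding P meets the type I quotas.
  president-replaces : ∀ s (T : Subset 535) →
    Winning (outside ∷ insertAt T (suc (s ↑ˡ 435)) inside) →
    Winning (inside ∷ insertAt T (suc (s ↑ˡ 435)) outside)
  president-replaces s (v ∷ T) win with splitAt 99 T
  ... | A , B , refl =
    let s′ , r = Equivalence.to (winning-senator⇔ s false v inside A B) win in
    Equivalence.from (winning-senator⇔ s true v outside A B)
      ( ≤-trans (≤-trans (≤ᵇ⇒≤ 51 66 tt) (s≤s⁻¹ (≤-trans s′ (≤-reflexive (∣insertAt∣ A s)))))
                (≤-trans (≤-reflexive (sym (∣insertAt-out∣ A s))) (∣p∣≤∣x∷p∣ v (insertAt A s outside)))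
      , ≤-trans (≤ᵇ⇒≤ 218 290 tt) r)

  -- senator s unfolds to suc (suc (s ↑ˡ 435)); the subst₂ compares the players
  -- alone, where comparing the two critical counts would unfold them.
  senator≤president : ∀ s k → criticalCount G (senator s) k ≤ criticalCount G president k
  senator≤president s k = subst₂ (λ i j → criticalCount G i k ≤ criticalCount G j k)
    {suc (suc (s ↑ˡ 435))} {senator s} {zero} {president} refl refl
    (replace⇒≤ G (suc (s ↑ˡ 435)) (president-replaces s) k)

  -- `A` omits S, who brings one more senator; hence the bound 66 where the quota is 67.
  president-replaces-strictly : ∀ s v (A : Subset 99) (B : Subset 435) →
    51 ≤ ∣ v ∷ A ∣ → 218 ≤ ∣ B ∣ → ∣ A ∣ < 66 ⊎ ∣ B ∣ < 290 →
    Replaces G (suc (s ↑ˡ 435)) (president-replaces s) (v ∷ (A ++ B))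
  president-replaces-strictly s v A B f r out =
    Equivalence.from (winning-senator⇔ s true v outside A B)
      (≤-trans f (≤-reflexive (sym (∣∷insertAt-out∣ v A s))) , r) ,
    λ win → let s′ , r′ = Equivalence.to (winning-senator⇔ s false v inside A B) win in
      [ (λ a<66 → <⇒≱ (s≤s a<66) (≤-trans s′ (≤-reflexive (∣insertAt∣ A s)))) , (λ b<290 → <⇒≱ b<290 r′) ]′ out

  -- The coalition described omits P and S; it is to reach size k with P added, or with both P and S
  -- added.
  Separating : ℕ → Bool → Subset 99 → Subset 435 → Set
  Separating k v A B = (51 ≤ ∣ v ∷ A ∣ × 218 ≤ ∣ B ∣ × (∣ A ∣ < 66 ⊎ ∣ B ∣ < 290)) ×
                       (1 + ∣ v ∷ (A ++ B) ∣ ≡ k ⊎ 2 + ∣ v ∷ (A ++ B) ∣ ≡ k)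

  separating⇒< : ∀ s k → ∃[ v ] ∃[ A ] ∃[ B ] Separating k v A B →
    criticalCount G (senator s) k < criticalCount G president k
  separating⇒< s k (v , A , B , (f , r , out) , size) =
    subst₂ (λ i j → criticalCount G i k < criticalCount G j k)
      {suc (suc (s ↑ˡ 435))} {senator s} {zero} {president} refl refl
      (replace⇒< G (suc (s ↑ˡ 435)) (president-replaces s) k (v ∷ (A ++ B))
        (president-replaces-strictly s v A B f r out) size)

  -- In continuation style `A` and `B` remain variables, known only through their sizes.
  withSizes : ∀ {C : Set} a b → a ≤ 99 → b ≤ 435 →
    (∀ (A : Subset 99) → ∣ A ∣ ≡ a → ∀ (B : Subset 435) → ∣ B ∣ ≡ b → C) → C
  withSizes a b a≤ b≤ use = uncurry (uncurry use (subsetOfSize 99 a a≤)) (subsetOfSize 435 b b≤)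

  -- Up to k = 487 and k = 502, 51 senators without V and 65 senators with V leave
  -- room for the remaining k - 52 and k - 67 representatives.  The size 503 is
  -- reached only by the coalitions containing both P and S.
  separating : ∀ k → 270 ≤ k → k ≤ 503 → ∃[ v ] ∃[ A ] ∃[ B ] Separating k v A B
  separating k 270≤k k≤503 with k ≤? 487 | k ≤? 502
  ... | yes k≤487 | _ =
    withSizes 51 (k ∸ 52) (≤ᵇ⇒≤ 51 99 tt) (∸-monoˡ-≤ 52 k≤487) λ A ∣A∣ B ∣B∣ → false , A , B ,
       ( ≤-reflexive (sym ∣A∣)
       , ≤-trans (∸-monoˡ-≤ 52 270≤k) (≤-reflexive (sym ∣B∣))
       , inj₁ (≤-trans (≤-reflexive (cong suc ∣A∣)) (≤ᵇ⇒≤ 52 66 tt)) ) ,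
       inj₁ (trans (cong suc (trans (∣++∣ A B) (cong₂ _+_ ∣A∣ ∣B∣)))
                   (m+[n∸m]≡n {52} (≤-trans (≤ᵇ⇒≤ 52 270 tt) 270≤k)))
  ... | no k≰487 | yes k≤502 =
    withSizes 65 (k ∸ 67) (≤ᵇ⇒≤ 65 99 tt) (∸-monoˡ-≤ 67 k≤502) λ A ∣A∣ B ∣B∣ → true , A , B ,
       ( ≤-trans (≤ᵇ⇒≤ 51 66 tt) (≤-reflexive (cong suc (sym ∣A∣)))
       , ≤-trans (≤-trans (≤ᵇ⇒≤ 218 421 tt) (∸-monoˡ-≤ 67 (≰⇒> k≰487))) (≤-reflexive (sym ∣B∣))
       , inj₁ (≤-reflexive (cong suc ∣A∣)) ) ,
       inj₁ (trans (cong (2 +_) (trans (∣++∣ A B) (cong₂ _+_ ∣A∣ ∣B∣)))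
                   (m+[n∸m]≡n {67} (≤-trans (≤ᵇ⇒≤ 67 488 tt) (≰⇒> k≰487))))
  ... | no _ | no k≰502 =
    withSizes 65 435 (≤ᵇ⇒≤ 65 99 tt) ≤-refl λ A ∣A∣ B ∣B∣ → true , A , B ,
       ( ≤-trans (≤ᵇ⇒≤ 51 66 tt) (≤-reflexive (cong suc (sym ∣A∣)))
       , ≤-trans (≤ᵇ⇒≤ 218 435 tt) (≤-reflexive (sym ∣B∣))
       , inj₁ (≤-reflexive (cong suc ∣A∣)) ) ,
       inj₂ (trans (cong (3 +_) (trans (∣++∣ A B) (cong₂ _+_ ∣A∣ ∣B∣)))
                   (≤-antisym (≰⇒> k≰502) k≤503))

  outOfRange⇒≡0 : ∀ s k → k < 270 ⊎ 503 < k →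
    criticalCount G president k ≡ 0 × criticalCount G (senator s) k ≡ 0
  outOfRange⇒≡0 s k k-out =
    P≡0 , n≤0⇒n≡0 (subst (criticalCount G (senator s) k ≤_) P≡0 (senator≤president s k))
    where
    P≡0 : criticalCount G president k ≡ 0
    P≡0 = criticalCount-president≡0 k k-out

  -- The two decisions are arguments, so that no `with` abstracts over a goal containing critical
  -- counts.
  senator<president : ∀ s k →
    ¬ (criticalCount G president k ≡ 0 × criticalCount G (senator s) k ≡ 0) →
    Dec (270 ≤ k) → Dec (k ≤ 503) → criticalCount G (senator s) k < criticalCount G president k
  senator<president s k ¬both (yes 270≤k) (yes k≤503) =
    separating⇒< s k (separating k 270≤k k≤503)
  senator<president s k ¬both (no 270≰k)  _           =
    contradiction (outOfRange⇒≡0 s k (inj₁ (≰⇒> 270≰k))) ¬both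
  senator<president s k ¬both _           (no k≰503)  =
    contradiction (outOfRange⇒≡0 s k (inj₂ (≰⇒> k≰503))) ¬both

  president≻senator : ∀ s → president ≻[ G ] senator s
  president≻senator s k _ _ ¬both = senator<president s k ¬both (270 ≤? k) (k ≤? 503)

  senator≻representative : ∀ s r → senator s ≻[ G ] representative r
  senator≻representative s r k _ k≤n = subst₂ (λ x y → ¬ (x ≡ 0 × y ≡ 0) → y < x)
    (sym (criticalCount-senator s k)) (sym (criticalCount-representative r k))
    (senatorCount-≻-representativeCount k k≤n)

  senator⪰vicePresident : ∀ s → senator s ⪰[ G ] vicePresident
  senator⪰vicePresident s k _ k≤n = subst₂ _≤_
    (sym (criticalCount-vicePresident k)) (sym (criticalCount-senator s k))
    (vicePresidentCount≤senatorCount k k≤n)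

  -- Power indices of the players

  module _ {c ℓ₁ ℓ₂} (K : OrderedField c ℓ₁ ℓ₂) (s : Fin 100) (r : Fin 435) where
    open PowerIndexProperties K
      using (powerIndex-mono-≻; powerIndex-mono-⪰; powerIndex-mono-≻->;
             banzhaf-pos; banzhaf-<; shapleyShubik-pos; shapleyShubik-<)
    open OrderedField K using (_≈_; 0#; _>ᶠ_; _≥ᶠ_)

    totals-senator-vicePresident : ∀ g →
      weightedTotal 537 vicePresidentCount g < weightedTotal 537 senatorCount g →
      weightedTotal 537 (criticalCount G vicePresident) g <
      weightedTotal 537 (criticalCount G (senator s)) g
    totals-senator-vicePresident g = subst₂ _<_
      (sym (weightedTotal-cong 537 g criticalCount-vicePresident))
      (sym (weightedTotal-cong 537 g (criticalCount-senator s)))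

    totals-vicePresident-representative : ∀ g →
      weightedTotal 537 representativeCount g < weightedTotal 537 vicePresidentCount g →
      weightedTotal 537 (criticalCount G (representative r)) g <
      weightedTotal 537 (criticalCount G vicePresident) g
    totals-vicePresident-representative g = subst₂ _<_
      (sym (weightedTotal-cong 537 g (criticalCount-representative r)))
      (sym (weightedTotal-cong 537 g criticalCount-vicePresident))

    powerIndex-order : ∀ w → (∀ m → w m ≥ᶠ 0#) → let Φ = powerIndex K G w in
      ¬ (Φ president ≈ 0#) → ¬ (Φ (senator s) ≈ 0#) →
      Φ president >ᶠ Φ (senator s) × Φ (senator s) >ᶠ Φ (representative r) ×
      Φ (senator s) ≥ᶠ Φ vicePresident
    powerIndex-order w w≥0 ΦP≉0 ΦS≉0 =
      powerIndex-mono-≻ G w w≥0 president (senator s) (president≻senator s) ΦP≉0 ,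
      powerIndex-mono-≻ G w w≥0 (senator s) (representative r) (senator≻representative s r) ΦS≉0 ,
      powerIndex-mono-⪰ G w w≥0 (senator s) vicePresident (senator⪰vicePresident s)

    banzhaf-order : let Φ = powerIndex K G (banzhaf K 537) in
      Φ president >ᶠ Φ (senator s) × Φ (senator s) >ᶠ Φ vicePresident ×
      Φ vicePresident >ᶠ Φ (representative r)
    banzhaf-order =
      -- There is no closed form for the counts of P; P > S follows from P ≻ S, with S > V excluding
      -- that both indices vanish.
      powerIndex-mono-≻-> G (banzhaf K 537) (λ m → inj₁ (banzhaf-pos 537 m))
        president (senator s) vicePresident (president≻senator s) S>V ,
      S>V ,
      banzhaf-< G vicePresident (representative r)
        (totals-vicePresident-representative (λ _ → 1) representativeTotal<vicePresidentTotal)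
      where
      S>V : powerIndex K G (banzhaf K 537) (senator s) >ᶠ
            powerIndex K G (banzhaf K 537) vicePresident
      S>V = banzhaf-< G (senator s) vicePresident
        (totals-senator-vicePresident (λ _ → 1) vicePresidentTotal<senatorTotal)

    shapleyShubik-order : let Φ = powerIndex K G (shapleyShubik K 537) in
      Φ president >ᶠ Φ (senator s) × Φ (senator s) >ᶠ Φ vicePresident ×
      Φ vicePresident >ᶠ Φ (representative r)
    shapleyShubik-order =
      powerIndex-mono-≻-> G (shapleyShubik K 537)
        (λ m → inj₁ (shapleyShubik-pos {537} {536} refl m))
        president (senator s) vicePresident (president≻senator s) S>V ,
      S>V ,
      shapleyShubik-< {537} {536} refl G vicePresident (representative r)
        (totals-vicePresident-representative (factorialWeight 536)
          representativeFactorialTotal<vicePresidentFactorialTotal)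
      where
      S>V : powerIndex K G (shapleyShubik K 537) (senator s) >ᶠ
            powerIndex K G (shapleyShubik K 537) vicePresident
      S>V = shapleyShubik-< {537} {536} refl G (senator s) vicePresident
        (totals-senator-vicePresident (factorialWeight 536) vicePresidentFactorialTotal<senatorFactorialTotal)

-- Winning coalitions described by quotas

open SimpleGame usLegislature using (Winning)

-- Beside P, the type I quotas cover both types, since 67 ≥ 51 and 290 ≥ 218; without P only type II
-- can occur. Conversely, each block is trimmed to its exact quota to obtain a minimal coalition.
winning⇔ : ∀ p v (A : Subset 100) (B : Subset 435) →
           Winning (p ∷ v ∷ (A ++ B)) ⇔ Wins p (∣ v ∷ A ∣) (∣ A ∣) (∣ B ∣)
winning⇔ p v A B = mk⇔ (to p) (from p)
  where
  bound : ∀ {q} p {U} → U ⊆ p ∷ v ∷ (A ++ B) → ∀ V {c} →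
    ∣ U ∩ V ∣ ≡ q → ∣ (p ∷ v ∷ (A ++ B)) ∩ V ∣ ≡ c → q ≤ c
  bound p U⊆T V refl refl = ∣∩∣-mono U⊆T V

  to : ∀ p → Winning (p ∷ v ∷ (A ++ B)) → Wins p (∣ v ∷ A ∣) (∣ A ∣) (∣ B ∣)
  to true  (U , U⊆T , inj₁ (_ , f , r)) =
    bound true U⊆T fullSenate f (∣∩fullSenate∣ A B true v) ,
    bound true U⊆T representatives r (∣∩representatives∣ A B true v)
  to false (U , U⊆T , inj₁ (P∈U , _)) with () ← U⊆T P∈U
  to true  (U , U⊆T , inj₂ (_ , s , r)) =
    ≤-trans (≤ᵇ⇒≤ 51 67 tt)
      (≤-trans (bound true U⊆T senators s (∣∩senators∣ A B true v)) (∣p∣≤∣x∷p∣ v A)) ,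
    ≤-trans (≤ᵇ⇒≤ 218 290 tt) (bound true U⊆T representatives r (∣∩representatives∣ A B true v))
  to false (U , U⊆T , inj₂ (_ , s , r)) =
    bound false U⊆T senators s (∣∩senators∣ A B false v) ,
    bound false U⊆T representatives r (∣∩representatives∣ A B false v)

  from : ∀ p → Wins p (∣ v ∷ A ∣) (∣ A ∣) (∣ B ∣) → Winning (p ∷ v ∷ (A ++ B))
  from true  (f , r) with chooseSubset (v ∷ A) 51 f | chooseSubset B 218 r
  ... | v′ ∷ A′ , A′⊆A , f′ | B′ , B′⊆B , r′ =
    inside ∷ v′ ∷ (A′ ++ B′) ,
    s⊆s (++-mono-⊆ A′⊆A B′⊆B) ,
    inj₁ (here , trans (∣∩fullSenate∣ A′ B′ true v′) f′ ,
          trans (∣∩representatives∣ A′ B′ true v′) r′)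
  from false (s , r) with chooseSubset A 67 s | chooseSubset B 290 r
  ... | A′ , A′⊆A , s′ | B′ , B′⊆B , r′ =
    -- V is dropped even if present, because type II admits only senators and representatives.
    outside ∷ outside ∷ (A′ ++ B′) ,
    s⊆s (λ { (there i∈) → there (++-mono-⊆ A′⊆A B′⊆B i∈) }) ,
    -- Beyond the first two players, senators and representatives together are everybody.
    inj₂ (s⊆s (s⊆s (subst (A′ ++ B′ ⊆_) (sym (⊤++⊥∪⊥++⊤≡⊤ 100 435)) ⊆⊤)) ,
          trans (∣∩senators∣ A′ B′ false false) s′ ,
          trans (∣∩representatives∣ A′ B′ false false) r′)

theorem3 :
    ∀ {c ℓ₁ ℓ₂} (K : OrderedField c ℓ₁ ℓ₂) →
    let open OrderedField K
        open PowerIndices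
        G = usLegislature
        P = president
        V = vicePresident
    in
    ∀ (s : Fin 100) (r : Fin 435) →
    let S = senator s
        R = representative r
    in
      (P ≻[ G ] S × S ≻[ G ] R × S ⪰[ G ] V)
    × (∀ (w : Fin 537 → Carrier) → IsWeighting K w →
       let Φ = powerIndex K G w in
       ¬ (Φ P ≈ 0#) → ¬ (Φ S ≈ 0#) →
       Φ P >ᶠ Φ S × Φ S >ᶠ Φ R × Φ S ≥ᶠ Φ V)
    × (let Φ = powerIndex K G (banzhaf K 537) in
       Φ P >ᶠ Φ S × Φ S >ᶠ Φ V × Φ V >ᶠ Φ R)
    × (let Φ = powerIndex K G (shapleyShubik K 537) in
       Φ P >ᶠ Φ S × Φ S >ᶠ Φ V × Φ V >ᶠ Φ R)
theorem3 K s r =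
  (president≻senator usLegislature winning⇔ s ,
   senator≻representative usLegislature winning⇔ s r ,
   senator⪰vicePresident usLegislature winning⇔ s) ,
  (λ w isWeighting → powerIndex-order usLegislature winning⇔ K s r w
                       (IsWeighting.nonNegative isWeighting)) ,
  banzhaf-order usLegislature winning⇔ K s r ,
  shapleyShubik-order usLegislature winning⇔ K s r
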